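{- Let $G$ be a graph with $m\ge 1$ edges, let $M_2=4I+B$ where $B$ is the adjacency matrix of the line graph of $G$, let $f(\mathbf{w})=\mathbf{w}^\top M_2\mathbf{w}$, and let $R=\{\mathbf{w}\in\mathbb{R}^{E(G)}:\mathbf{1}^\top\mathbf{w}=m,\ \mathbf{w}\ge 0\text{ entrywise}\}$. Let $\alpha$ be a nonempty subset of $E(G)$. Then there is a local minimum $\mathbf{w}$ of $f$ on $R$ with $\operatorname{supp}(\mathbf{w})=\alpha$ if and only if 1. $M_2[\alpha]^{ -1}\mathbf{1}$ is entrywise positive, and 2. $M_2(\alpha]\,M_2[\alpha]^{ -1}\mathbf{1}$ is entrywise greater than or equal to $1$. If these conditions hold, then the vector $\mathbf{w}$ given by $\mathbf{w}[\alpha]=kM_2[\alpha]^{ -1}\mathbf{1}$ with $k=\dfrac{m}{\mathbf{1}^\top M_2[\alpha]^{ -1}\mathbf{1}}$ and $\mathbf{w}(\alpha)=\mathbf{0}$ is the only local minimum of $f$ on $R$ with support $\alpha$.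
   Context: Graphs are finite and simple. The line graph of $G$ has vertex set $E(G)$, two distinct edges being adjacent when they share a vertex. The support $\operatorname{supp}(\mathbf{w})$ is the set of indices at which $\mathbf{w}$ is nonzero. $M_2[\alpha]$ is the principal submatrix of $M_2$ on rows and columns in $\alpha$; $M_2(\alpha]$ is the submatrix with rows not in $\alpha$ and columns in $\alpha$; $\mathbf{w}[\alpha]$ and $\mathbf{w}(\alpha)$ are the subvectors of $\mathbf{w}$ on indices in $\alpha$ and not in $\alpha$, respectively. $\mathbf{1}$ is the all-ones vector of the appropriate size. $M_2$ is positive definite. A local minimum of $f$ on $R$ is a point $\mathbf{w}\in R$ such that $f(\mathbf{w})\le f(\mathbf{v})$ for all $\mathbf{v}\in R$ sufficiently close to $\mathbf{w}$. -}

module Defs where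

open import Level using (Level; 0ℓ; _⊔_) renaming (suc to lsuc)
open import Algebra.Apartness.Bundles using (HeytingCommutativeRing; HeytingField)
open import Algebra.Bundles using (CommutativeRing)
open import Data.Bool.Base using (if_then_else_)
open import Data.Fin.Base using (Fin; zero; suc)
open import Data.Fin.Properties using (_≟_; _<?_; any?)
open import Data.Fin.Subset using (Subset; inside; outside; ∣_∣; ∁; _∈_)
open import Data.List.Base using (List; length; lookup; filter; allFin; cartesianProduct)
open import Data.Nat.Base as ℕ using (ℕ)
open import Data.Product.Base using (∃-syntax; _×_; _,_; proj₁; proj₂)
open import Data.Sum.Base using (_⊎_)
open import Data.Vec.Base using (_∷_)
open import Function.Bundles using (_⇔_)
open import Relation.Binary.Core using (Rel)
open import Relation.Binary.Definitions using (Decidable; Symmetric)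
open import Relation.Binary.PropositionalEquality.Core using (_≡_; _≢_; ≢-sym)
open import Relation.Binary.Structures using (IsStrictPartialOrder)
open import Relation.Nullary.Decidable using (Dec; does; _×-dec_; _⊎-dec_; ¬?)
open import Relation.Nullary.Negation using (¬_)
import Algebra.Properties.Semiring.Mult as SemiringMult
import Algebra.Properties.Semiring.Sum as SemiringSum

------------------------------------------------------------------------
-- The real numbers, given by axioms: a Cauchy-complete Archimedean
-- ordered field.  Classically this determines ℝ up to isomorphism; the
-- axioms are phrased (apartness, cotransitivity of _#_, x ≤ y as
-- ¬ y < x) so that they are also satisfied by the constructive Cauchy
-- reals.

record RealField (c ℓ₁ ℓ₂ ℓ₃ : Level) : Set (lsuc (c ⊔ ℓ₁ ⊔ ℓ₂ ⊔ ℓ₃)) where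
  infix 4 _<_ _≤_
  field
    heytingField : HeytingField c ℓ₁ ℓ₂

  open HeytingField heytingField public
  open HeytingCommutativeRing heytingCommutativeRing public using (commutativeRing)
  open CommutativeRing commutativeRing public using (semiring)
  open SemiringSum semiring public using (sum)
  open SemiringMult semiring public using () renaming (_×_ to _·_)

  field
    _<_                  : Rel Carrier ℓ₃
    isStrictPartialOrder : IsStrictPartialOrder _≈_ _<_
    #⇔<⊎>                : ∀ {x y} → x # y ⇔ (x < y ⊎ y < x)
    +-monoˡ-<            : ∀ {x y} z → x < y → x + z < y + z
    *-pos                : ∀ {x y} → 0# < x → 0# < y → 0# < x * y

  _≤_ : Rel Carrier ℓ₃
  x ≤ y = ¬ (y < x)

  -- ∣ x - y ∣ < ε
  Within : Carrier → Rel Carrier ℓ₃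
  Within ε x y = (x - y < ε) × (y - x < ε)

  IsCauchy : (ℕ → Carrier) → Set (c ⊔ ℓ₃)
  IsCauchy s = ∀ ε → 0# < ε →
    ∃[ N ] ∀ i j → N ℕ.≤ i → N ℕ.≤ j → Within ε (s i) (s j)

  _⟶_ : (ℕ → Carrier) → Carrier → Set (c ⊔ ℓ₃)
  s ⟶ x = ∀ ε → 0# < ε → ∃[ N ] ∀ i → N ℕ.≤ i → Within ε (s i) x

  field
    archimedean : ∀ x → ∃[ n ] x < n · 1#
    complete    : ∀ s → IsCauchy s → ∃[ x ] s ⟶ x

  -- The library states invertibility of differences, so the inverse
  -- chosen here is that of y - 0#.
  divide : (x y : Carrier) → y # 0# → Carrier
  divide x y y#0 = x * proj₁ (#⇒invertible y#0)

------------------------------------------------------------------------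
-- Finite simple graphs on the vertex set Fin n

record Graph (n : ℕ) : Set₁ where
  field
    Adj    : Rel (Fin n) 0ℓ
    adj?   : Decidable Adj
    sym    : Symmetric Adj
    irrefl : ∀ {u} → ¬ Adj u u

  -- Each edge {u , v} is listed once, as the pair with u < v.
  edges : List (Fin n × Fin n)
  edges = filter (λ (u , v) → (u <? v) ×-dec adj? u v)
                 (cartesianProduct (allFin n) (allFin n))

  size : ℕ
  size = length edges

  -- The edge set E(G) is represented by the index set Fin size.
  ends : Fin size → Fin n × Fin n
  ends = lookup edges

  Incident : Fin n → Fin size → Set
  Incident x e = x ≡ proj₁ (ends e) ⊎ x ≡ proj₂ (ends e)

  incident? : Decidable Incident
  incident? x e = (x ≟ proj₁ (ends e)) ⊎-dec (x ≟ proj₂ (ends e))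

  ShareVertex : Rel (Fin size) 0ℓ
  ShareVertex e f = ∃[ x ] Incident x e × Incident x f

  shareVertex? : Decidable ShareVertex
  shareVertex? e f = any? (λ x → incident? x e ×-dec incident? x f)

open Graph using (size)

lineGraph : ∀ {n} (G : Graph n) → Graph (size G)
lineGraph G = record
  { Adj    = λ e f → e ≢ f × ShareVertex e f
  ; adj?   = λ e f → ¬? (e ≟ f) ×-dec shareVertex? e f
  ; sym    = λ (e≢f , x , x∈e , x∈f) → ≢-sym e≢f , x , x∈f , x∈e
  ; irrefl = λ (e≢e , _) → e≢e _≡_.refl
  }
  where open Graph G

------------------------------------------------------------------------

-- The increasing enumeration of the elements of a subset
members : ∀ {n} (p : Subset n) → Fin ∣ p ∣ → Fin n
members (inside  ∷ p) zero    = zero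
members (inside  ∷ p) (suc i) = suc (members p i)
members (outside ∷ p) i       = suc (members p i)

module LinearAlgebra {c ℓ₁ ℓ₂ ℓ₃} (ℝ : RealField c ℓ₁ ℓ₂ ℓ₃) where

  open RealField ℝ

  Vector : ℕ → Set c
  Vector n = Fin n → Carrier

  Matrix : ℕ → ℕ → Set c
  Matrix m n = Fin m → Fin n → Carrier

  infix  4 _≋_
  infixl 6 _⊕_
  infixr 7 _∙_ _*ᵥ_ _*ₘ_ _*ₛ_
  infix  8 _[_] _⟨_] _↾_

  _≋_ : ∀ {n} → Rel (Vector n) ℓ₁
  v ≋ w = ∀ i → v i ≈ w i

  𝟎 𝟏 : ∀ {n} → Vector n
  𝟎 _ = 0#
  𝟏 _ = 1#

  _∙_ : ∀ {n} → Vector n → Vector n → Carrier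
  v ∙ w = sum (λ i → v i * w i)

  _*ₛ_ : ∀ {n} → Carrier → Vector n → Vector n
  (k *ₛ v) i = k * v i

  _*ᵥ_ : ∀ {m n} → Matrix m n → Vector n → Vector m
  (M *ᵥ v) i = M i ∙ v

  _*ₘ_ : ∀ {l m n} → Matrix l m → Matrix m n → Matrix l n
  (M *ₘ N) i j = sum (λ k → M i k * N k j)

  _⊕_ : ∀ {m n} → Matrix m n → Matrix m n → Matrix m n
  (M ⊕ N) i j = M i j + N i j

  indicator : ∀ {a} {P : Set a} → Dec P → Carrier
  indicator P? = if does P? then 1# else 0#

  scalar : ∀ {n} → Carrier → Matrix n n
  scalar k i j = k * indicator (i ≟ j)

  IsInverse : ∀ {n} → Matrix n n → Matrix n n → Set ℓ₁
  IsInverse M N = (∀ i → (M *ₘ N) i ≋ scalar 1# i) × (∀ i → (N *ₘ M) i ≋ scalar 1# i)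

  -- w ↾ α is w[α], and w ↾ ∁ α is w(α).
  _↾_ : ∀ {n} → Vector n → (α : Subset n) → Vector ∣ α ∣
  (w ↾ α) i = w (members α i)

  _[_] : ∀ {n} → Matrix n n → (α : Subset n) → Matrix ∣ α ∣ ∣ α ∣
  (M [ α ]) i j = M (members α i) (members α j)

  -- M ⟨ α ] is M(α]: rows not in α, columns in α.
  _⟨_] : ∀ {n} → Matrix n n → (α : Subset n) → Matrix ∣ ∁ α ∣ ∣ α ∣
  (M ⟨ α ]) i j = M (members (∁ α) i) (members α j)

  HasSupport : ∀ {n} → Vector n → Subset n → Set ℓ₂
  HasSupport w α = ∀ i → w i # 0# ⇔ i ∈ α

  -- Closeness is measured coordinatewise (sup norm), which induces the
  -- usual topology of ℝⁿ.
  IsLocalMin : ∀ {n ℓ} → (Vector n → Carrier) → (Vector n → Set ℓ) → Vector n →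
               Set (c ⊔ ℓ₃ ⊔ ℓ)
  IsLocalMin f R w = R w ×
    (∃[ ε ] 0# < ε × (∀ v → R v → (∀ i → Within ε (v i) (w i)) → f w ≤ f v))

  adjacencyMatrix : ∀ {n} → Graph n → Matrix n n
  adjacencyMatrix G u v = indicator (Graph.adj? G u v)

  module _ {n : ℕ} (G : Graph n) where

    M₂ : Matrix (size G) (size G)
    M₂ = scalar (4 · 1#) ⊕ adjacencyMatrix (lineGraph G)

    f : Vector (size G) → Carrier
    f w = w ∙ (M₂ *ᵥ w)

    R : Vector (size G) → Set (ℓ₁ ⊔ ℓ₃)
    R w = (𝟏 ∙ w ≈ size G · 1#) × (∀ i → 0# ≤ w i)

    IsLocalMinWithSupport : Subset (size G) → Vector (size G) → Set (c ⊔ ℓ₁ ⊔ ℓ₂ ⊔ ℓ₃)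
    IsLocalMinWithSupport α w = IsLocalMin f R w × HasSupport w α

    -- N plays the role of M₂[α]⁻¹.
    Conditions : (α : Subset (size G)) → Matrix ∣ α ∣ ∣ α ∣ → Set ℓ₃
    Conditions α N = (∀ i → 0# < (N *ᵥ 𝟏) i)
                   × (∀ i → 1# ≤ (M₂ ⟨ α ] *ᵥ N *ᵥ 𝟏) i)

{-# OPTIONS --safe #-}

-- Write gᵢ = (M₂ w)ᵢ.  Moving a little mass from an index i of the support to
-- any index j stays in R, so at a local minimum gᵢ ≤ gⱼ: the vector g equals a
-- constant k on α and is at least k off α.  Restricted to α this reads
-- M₂[α] w[α] = k 𝟏, hence w[α] = k M₂[α]⁻¹ 𝟏, and pairing g with w gives
-- k m = f w > 0; dividing by k turns w[α] > 0 and g ≥ k into conditions 1 and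
-- 2, and 𝟏ᵀw = m determines k.  Conversely, if w is so defined, then
-- f v − f w = 2 (v − w)ᵀg + f (v − w) ≥ 0 for all v in R, because v − w has
-- mass 0, g − k vanishes on α, and v − w and g − k are nonnegative off α.
-- Positive definiteness comes from M₂ = 2I + CᵀC with C the vertex-edge
-- incidence matrix; it also makes all pivots positive, so that linear systems
-- over M₂[α] are solved by Schur complements.

module Submission where

open import Defs
open import Algebra.Bundles using (CommutativeRing)
open import Algebra.Solver.Ring.AlmostCommutativeRing
  using (fromCommutativeRing; _-Raw-AlmostCommutative⟶_)
open import Data.Fin.Base as Fin using (Fin; zero; suc)
open import Data.Fin.Properties as Finₚ using (_≟_; _<?_)
open import Data.Fin.Subset using (Subset; inside; outside; Nonempty; ∣_∣; ∁; _∈_)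
open import Data.Fin.Subset.Properties using (_∈?_; x∉p⇒x∈∁p; x∈∁p⇒x∉p)
open import Data.Integer.Base as ℤ using (ℤ; +_; -[1+_]; _⊖_)
import Data.Integer.Properties as ℤₚ
open import Data.List.Base using (List; lookup; cartesianProduct; allFin)
open import Data.List.Membership.Propositional.Properties using (∈-lookup)
import Data.List.Relation.Unary.All as All
open import Data.List.Relation.Unary.All.Properties using (all-filter)
open import Data.List.Relation.Unary.AllPairs using (_∷_)
open import Data.List.Relation.Unary.Unique.Propositional using (Unique)
import Data.List.Relation.Unary.Unique.Propositional.Properties as Unique
import Data.Maybe.Base as Maybe
open import Data.Nat.Base as ℕ using (ℕ; zero; suc)
import Data.Nat.Properties as ℕₚ
open import Data.Product.Base using (Σ-syntax; ∃-syntax; _×_; _,_; proj₁; proj₂)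
open import Data.Product.Properties using (×-≡,≡→≡)
open import Data.Sum.Base using (_⊎_; inj₁; inj₂; [_,_]′)
open import Data.Vec.Base using ([]; _∷_; here; there)
open import Function.Base using (_∘_)
open import Function.Bundles using (_⇔_; mk⇔; module Equivalence)
open import Level using (Level; _⊔_)
open import Relation.Binary.Consequences using (dec⇒weaklyDec)
open import Relation.Binary.PropositionalEquality.Core as ≡ using (_≡_; _≢_)
open import Relation.Binary.Structures using (IsStrictPartialOrder)
open import Relation.Nullary.Decidable using (Dec; yes; no; _⊎-dec_; _×-dec_)
open import Relation.Nullary.Negation using (¬_; contradiction)
import Algebra.Apartness.Properties.HeytingCommutativeRing as HeytingProperties
import Algebra.Properties.Ring as RingProperties
import Algebra.Properties.Semiring.Mult.TCOptimised as SemiringMult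
import Algebra.Properties.Semiring.Sum as SemiringSum
import Algebra.Solver.Ring
import Relation.Binary.Reasoning.Setoid as SetoidReasoning

-- A ring solver with integer coefficients.

module IntegerCoefficients {c ℓ : Level} (R : CommutativeRing c ℓ) where

  open CommutativeRing R
  open RingProperties ring
  open SemiringMult semiring using (1+×; ×-homo-+; ×1-homo-*) renaming (_×_ to _·_)
  open SetoidReasoning setoid

  -- The multiple `_·_` used here satisfies `1 · 1# = 1#` by computation, so `1-homo` is `refl` and
  -- `con (+ 1)` matches a literal `1#` in solver equations.
  ⟦_⟧ : ℤ → Carrier
  ⟦ + n ⟧      = n · 1#
  ⟦ -[1+ n ] ⟧ = - (suc n · 1#)

  ⟦⟧-cong : ∀ {i j} → i ≡ j → ⟦ i ⟧ ≈ ⟦ j ⟧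
  ⟦⟧-cong ≡.refl = refl

  private
    cancel-1 : ∀ x y → (1# + x) - (1# + y) ≈ x - y
    cancel-1 x y = begin
      (1# + x) + - (1# + y)    ≈⟨ +-cong (+-comm 1# x) (sym (-‿+-comm 1# y)) ⟩
      (x + 1#) + (- 1# + - y)  ≈⟨ +-assoc x 1# _ ⟩
      x + (1# + (- 1# + - y))  ≈⟨ +-congˡ (+-assoc 1# _ _) ⟨
      x + ((1# - 1#) + - y)    ≈⟨ +-congˡ (+-congʳ (-‿inverseʳ 1#)) ⟩
      x + (0# + - y)           ≈⟨ +-congˡ (+-identityˡ _) ⟩
      x - y                    ∎

  ⟦⟧-⊖ : ∀ m n → ⟦ m ⊖ n ⟧ ≈ m · 1# - n · 1#
  ⟦⟧-⊖ m       zero    = sym (trans (+-congˡ -0#≈0#) (+-identityʳ _))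
  ⟦⟧-⊖ zero    (suc n) = sym (+-identityˡ _)
  ⟦⟧-⊖ (suc m) (suc n) = begin
    ⟦ suc m ⊖ suc n ⟧                ≈⟨ ⟦⟧-cong (ℤₚ.[1+m]⊖[1+n]≡m⊖n m n) ⟩
    ⟦ m ⊖ n ⟧                        ≈⟨ ⟦⟧-⊖ m n ⟩
    m · 1# - n · 1#                  ≈⟨ cancel-1 _ _ ⟨
    (1# + m · 1#) - (1# + n · 1#)    ≈⟨ +-cong (1+× m 1#) (-‿cong (1+× n 1#)) ⟨
    suc m · 1# - suc n · 1#          ∎

  ⟦⟧-neg : ∀ i → ⟦ ℤ.- i ⟧ ≈ - ⟦ i ⟧
  ⟦⟧-neg (+ zero)  = sym -0#≈0#
  ⟦⟧-neg (+ suc n) = refl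
  ⟦⟧-neg -[1+ n ]  = sym (-‿involutive _)

  ⟦⟧-+ : ∀ i j → ⟦ i ℤ.+ j ⟧ ≈ ⟦ i ⟧ + ⟦ j ⟧
  ⟦⟧-+ (+ m)    (+ n)    = ×-homo-+ 1# m n
  ⟦⟧-+ (+ m)    -[1+ n ] = ⟦⟧-⊖ m (suc n)
  ⟦⟧-+ -[1+ m ] (+ n)    = trans (⟦⟧-⊖ n (suc m)) (+-comm _ _)
  ⟦⟧-+ -[1+ m ] -[1+ n ] = begin
    ⟦ -[1+ suc (m ℕ.+ n) ] ⟧           ≈⟨ ⟦⟧-cong (≡.cong -[1+_] (ℕₚ.+-suc m n)) ⟨
    - ((suc m ℕ.+ suc n) · 1#)         ≈⟨ -‿cong (×-homo-+ 1# (suc m) (suc n)) ⟩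
    - (suc m · 1# + suc n · 1#)        ≈⟨ -‿+-comm _ _ ⟨
    - (suc m · 1#) - (suc n · 1#)      ∎

  ⟦⟧-* : ∀ i j → ⟦ i ℤ.* j ⟧ ≈ ⟦ i ⟧ * ⟦ j ⟧
  ⟦⟧-* (+ m) (+ n) = trans (⟦⟧-cong (ℤₚ.+◃n≡+n (m ℕ.* n))) (×1-homo-* m n)
  ⟦⟧-* (+ m) -[1+ n ] = begin
    ⟦ + m ℤ.* -[1+ n ] ⟧                       ≈⟨ ⟦⟧-cong (ℤₚ.-◃n≡-n (m ℕ.* suc n)) ⟩
    ⟦ ℤ.- (+ (m ℕ.* suc n)) ⟧      ≈⟨ ⟦⟧-neg (+ (m ℕ.* suc n)) ⟩
    - ((m ℕ.* suc n) · 1#)         ≈⟨ -‿cong (×1-homo-* m (suc n)) ⟩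
    - (m · 1# * suc n · 1#)        ≈⟨ -‿distribʳ-* _ _ ⟩
    m · 1# * - (suc n · 1#)        ∎
  ⟦⟧-* -[1+ m ] (+ n) = begin
    ⟦ -[1+ m ] ℤ.* + n ⟧                       ≈⟨ ⟦⟧-cong (ℤₚ.-◃n≡-n (suc m ℕ.* n)) ⟩
    ⟦ ℤ.- (+ (suc m ℕ.* n)) ⟧      ≈⟨ ⟦⟧-neg (+ (suc m ℕ.* n)) ⟩
    - ((suc m ℕ.* n) · 1#)         ≈⟨ -‿cong (×1-homo-* (suc m) n) ⟩
    - (suc m · 1# * n · 1#)        ≈⟨ -‿distribˡ-* _ _ ⟩
    - (suc m · 1#) * n · 1#        ∎
  ⟦⟧-* -[1+ m ] -[1+ n ] = begin
    (suc m ℕ.* suc n) · 1#               ≈⟨ ×1-homo-* (suc m) (suc n) ⟩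
    suc m · 1# * suc n · 1#              ≈⟨ -‿involutive _ ⟨
    - (- (suc m · 1# * suc n · 1#))      ≈⟨ -‿cong (-‿distribˡ-* _ _) ⟩
    - (- (suc m · 1#) * suc n · 1#)      ≈⟨ -‿distribʳ-* _ _ ⟩
    - (suc m · 1#) * - (suc n · 1#)      ∎

  -- Coefficients are integers because normalisation has to recognise equal coefficients, and
  -- equality in the carrier is not decidable.
  homomorphism : ℤ.+-*-rawRing -Raw-AlmostCommutative⟶ fromCommutativeRing R
  homomorphism = record
    { ⟦_⟧    = ⟦_⟧
    ; +-homo = ⟦⟧-+
    ; *-homo = ⟦⟧-*
    ; -‿homo = ⟦⟧-neg
    ; 0-homo = refl
    ; 1-homo = refl
    }

  open Algebra.Solver.Ring ℤ.+-*-rawRing (fromCommutativeRing R) homomorphism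
    (λ i j → Maybe.map ⟦⟧-cong (dec⇒weaklyDec ℤₚ._≟_ i j)) public
    using (solve; _:+_; _:*_; _:-_; :-_; _:=_; con)

-- Ordered-field arithmetic without decidable order.

module Order {c ℓ₁ ℓ₂ ℓ₃ : Level} (ℝ : RealField c ℓ₁ ℓ₂ ℓ₃) where

  open RealField ℝ hiding (zero)
  open HeytingProperties heytingCommutativeRing using (x-0≈x; 1#0)
  open IntegerCoefficients commutativeRing
  open IsStrictPartialOrder isStrictPartialOrder public
    using () renaming (irrefl to <-irrefl; trans to <-trans; <-respˡ-≈ to <-respˡ; <-respʳ-≈ to <-respʳ)
  private module Apart {x y : Carrier} = Equivalence (#⇔<⊎> {x} {y})

  <-resp : ∀ {x x′ y y′} → x ≈ x′ → y ≈ y′ → x < y → x′ < y′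
  <-resp x≈x′ y≈y′ = <-respˡ x≈x′ ∘ <-respʳ y≈y′

  >⇒# : ∀ {x} → 0# < x → x # 0#
  >⇒# 0<x = Apart.from (inj₂ 0<x)

  -- Apartness is tight and amounts to one of the two strict inequalities, both of which are
  -- refuted.
  ≮⇒≈ : ∀ {x y} → ¬ (x < y) → ¬ (y < x) → x ≈ y
  ≮⇒≈ x≮y y≮x = proj₁ (tight _ _) ([ x≮y , y≮x ]′ ∘ Apart.to)

  -- This replaces trichotomy. Cotransitivity of `_#_` separates `z` from `x` or from `y`; if `z`
  -- lies below `x` or above `y`, transitivity yields the other alternative.
  <-cotrans : ∀ {x y} → x < y → ∀ z → x < z ⊎ z < y
  <-cotrans x<y z with #-cotrans (Apart.from (inj₁ x<y)) z
  ... | inj₁ x#z = [ inj₁ , (λ z<x → inj₂ (<-trans z<x x<y)) ]′ (Apart.to x#z)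
  ... | inj₂ z#y = [ inj₂ , (λ y<z → inj₁ (<-trans x<y y<z)) ]′ (Apart.to z#y)

  ≤-<-trans : ∀ {x y z} → x ≤ y → y < z → x < z
  ≤-<-trans x≤y y<z with <-cotrans y<z _
  ... | inj₁ y<x = contradiction y<x x≤y
  ... | inj₂ x<z = x<z

  <⇒≤ : ∀ {x y} → x < y → x ≤ y
  <⇒≤ x<y y<x = <-irrefl refl (<-trans x<y y<x)

  ≈⇒≤ : ∀ {x y} → x ≈ y → x ≤ y
  ≈⇒≤ x≈y = <-irrefl (sym x≈y)

  ≤-resp : ∀ {x x′ y y′} → x ≈ x′ → y ≈ y′ → x ≤ y → x′ ≤ y′
  ≤-resp x≈x′ y≈y′ x≤y = x≤y ∘ <-resp (sym y≈y′) (sym x≈x′)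

  diff-pos : ∀ {x y} → x < y → 0# < y - x
  diff-pos {x} {y} x<y = <-respˡ (-‿inverseʳ x) (+-monoˡ-< (- x) x<y)

  diff-pos⁻¹ : ∀ {x y} → 0# < y - x → x < y
  diff-pos⁻¹ {x} {y} 0<y-x =
    <-resp (+-identityˡ x) (solve 2 (λ x y → y :- x :+ x := y) refl x y) (+-monoˡ-< x 0<y-x)

  diff-nonneg : ∀ {x y} → x ≤ y → 0# ≤ y - x
  diff-nonneg {x} {y} x≤y y-x<0 = x≤y (<-resp
    (solve 2 (λ x y → y :- x :+ x := y) refl x y) (+-identityˡ x) (+-monoˡ-< x y-x<0))

  diff-nonneg⁻¹ : ∀ {x y} → 0# ≤ y - x → x ≤ y
  diff-nonneg⁻¹ {x} {y} 0≤y-x y<x = 0≤y-x (<-respʳ (-‿inverseʳ x) (+-monoˡ-< (- x) y<x))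

  +-pos-nonneg : ∀ {x y} → 0# < x → 0# ≤ y → 0# < x + y
  +-pos-nonneg {x} {y} 0<x 0≤y =
    ≤-<-trans 0≤y (<-respˡ (+-identityˡ y) (+-monoˡ-< y 0<x))

  +-nonneg-pos : ∀ {x y} → 0# ≤ x → 0# < y → 0# < x + y
  +-nonneg-pos 0≤x 0<y = <-respʳ (+-comm _ _) (+-pos-nonneg 0<y 0≤x)

  -- Since `_≤_` is a negation, the argument refutes `x + y < 0#`: comparing with `y` gives either
  -- `y < 0#` or, after cancelling `y`, `x < 0#`.
  +-nonneg : ∀ {x y} → 0# ≤ x → 0# ≤ y → 0# ≤ x + y
  +-nonneg {x} {y} 0≤x 0≤y x+y<0 with <-cotrans x+y<0 y
  ... | inj₂ y<0   = 0≤y y<0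
  ... | inj₁ x+y<y = 0≤x (<-resp
    (solve 2 (λ x y → x :+ y :- y := x) refl x y) (-‿inverseʳ y) (+-monoˡ-< (- y) x+y<y))

  neg-pos : ∀ {x} → x < 0# → 0# < - x
  neg-pos {x} x<0 = <-respʳ (+-identityˡ (- x)) (diff-pos x<0)

  square-pos : ∀ {x} → x # 0# → 0# < x * x
  square-pos {x} x#0 with Apart.to x#0
  ... | inj₂ 0<x = *-pos 0<x 0<x
  ... | inj₁ x<0 = <-respʳ (solve 1 (λ x → :- x :* :- x := x :* x) refl x)
                     (*-pos (neg-pos x<0) (neg-pos x<0))

  0<1 : 0# < 1#
  0<1 = <-respʳ (*-identityˡ 1#) (square-pos 1#0)

  inverse : ∀ {x} → 0# < x → Carrier
  inverse 0<x = proj₁ (#⇒invertible (>⇒# 0<x))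

  #-inverseˡ : ∀ {x} (x#0 : x # 0#) → proj₁ (#⇒invertible x#0) * x ≈ 1#
  #-inverseˡ {x} x#0 =
    trans (*-congˡ (sym (x-0≈x x))) (proj₁ (proj₂ (#⇒invertible x#0)))

  inverseˡ : ∀ {x} (0<x : 0# < x) → inverse 0<x * x ≈ 1#
  inverseˡ 0<x = #-inverseˡ (>⇒# 0<x)

  -- If r * x ≈ 1# then r is the product of x and the square of r.
  pos-inverse : ∀ {r x} → 0# < x → r * x ≈ 1# → 0# < r
  pos-inverse {r} {x} 0<x rx≈1 = <-respʳ eq (*-pos (square-pos r#0) 0<x)
    where
    eq : r * r * x ≈ r
    eq = trans (*-assoc r r x) (trans (*-congˡ rx≈1) (*-identityʳ r))
    r#0 : r # 0#
    r#0 = invertible⇒# (x , trans (*-congˡ (x-0≈x r)) (trans (*-comm x r) rx≈1)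
                          , trans (*-congʳ (x-0≈x r)) rx≈1)

  inverse-pos : ∀ {x} (0<x : 0# < x) → 0# < inverse 0<x
  inverse-pos 0<x = pos-inverse 0<x (inverseˡ 0<x)

  *-cancelˡ-pos : ∀ {x y} → 0# < x → 0# < x * y → 0# < y
  *-cancelˡ-pos {x} {y} 0<x 0<xy = <-respʳ
    (trans (sym (*-assoc _ x y)) (trans (*-congʳ (inverseˡ 0<x)) (*-identityˡ y)))
    (*-pos (inverse-pos 0<x) 0<xy)

  *-cancelˡ-pos-≈ : ∀ {x y z} → 0# < x → x * y ≈ x * z → y ≈ z
  *-cancelˡ-pos-≈ {x} {y} {z} 0<x xy≈xz = trans (undo y) (trans (*-congˡ xy≈xz) (sym (undo z)))
    where
    undo : ∀ y → y ≈ inverse 0<x * (x * y)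
    undo y = sym (trans (sym (*-assoc _ x y)) (trans (*-congʳ (inverseˡ 0<x)) (*-identityˡ y)))

  -- No case split on the sign of `x` is available. Given `x * y < 0#`, a positive `x` would force
  -- `y ≈ 0#` and make the product zero; hence `x` is not positive, so `x ≈ 0#` and the product is
  -- zero again.
  *-nonneg : ∀ {x y} → 0# ≤ x → 0# ≤ y → 0# ≤ x * y
  *-nonneg {x} {y} 0≤x 0≤y xy<0 = <-irrefl (trans (*-congʳ x≈0) (zeroˡ y)) xy<0
    where
    y≈0 : 0# < x → y ≈ 0#
    y≈0 0<x = ≮⇒≈ 0≤y (λ 0<y → <⇒≤ (*-pos 0<x 0<y) xy<0)
    x≈0 : x ≈ 0#
    x≈0 = ≮⇒≈ 0≤x (λ 0<x → <-irrefl (trans (*-congˡ (y≈0 0<x)) (zeroʳ x)) xy<0)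

  square-nonneg : ∀ x → 0# ≤ x * x
  square-nonneg x xx<0 = <-irrefl (trans (*-congˡ x≈0) (zeroʳ x)) xx<0
    where
    x≈0 : x ≈ 0#
    x≈0 = proj₁ (tight x 0#) (λ x#0 → <⇒≤ (square-pos x#0) xx<0)

  -- A minimum would require deciding the order. The witness `t = xy/(x+y)` works since
  -- `x - t = x²/(x+y)` and `y - t = y²/(x+y)` are positive.
  common-lower-bound : ∀ {x y} → 0# < x → 0# < y → ∃[ t ] 0# < t × t < x × t < y
  common-lower-bound {x} {y} 0<x 0<y =
    x * y * r , *-pos (*-pos 0<x 0<y) 0<r ,
    diff-pos⁻¹ (<-respʳ x-t (*-pos (*-pos 0<x 0<x) 0<r)) ,
    diff-pos⁻¹ (<-respʳ y-t (*-pos (*-pos 0<y 0<y) 0<r))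
    where
    0<x+y : 0# < x + y
    0<x+y = +-pos-nonneg 0<x (<⇒≤ 0<y)
    r : Carrier
    r = inverse 0<x+y
    0<r : 0# < r
    0<r = inverse-pos 0<x+y
    x-t : x * x * r ≈ x - x * y * r
    x-t = trans
      (solve 3 (λ x y r → x :* x :* r := x :* (r :* (x :+ y)) :- x :* y :* r) refl x y r)
      (+-congʳ (trans (*-congˡ (inverseˡ 0<x+y)) (*-identityʳ x)))
    y-t : y * y * r ≈ y - x * y * r
    y-t = trans
      (solve 3 (λ x y r → y :* y :* r := y :* (r :* (x :+ y)) :- x :* y :* r) refl x y r)
      (+-congʳ (trans (*-congˡ (inverseˡ 0<x+y)) (*-identityʳ y)))

  <-inverse⇒*< : ∀ {x y z} (0<z : 0# < z) → x < y * inverse 0<z → x * z < y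
  <-inverse⇒*< {x} {y} {z} 0<z x<y/z = diff-pos⁻¹ (<-respʳ eq (*-pos (diff-pos x<y/z) 0<z))
    where
    r : Carrier
    r = inverse 0<z
    eq : (y * r - x) * z ≈ y - x * z
    eq = trans (solve 4 (λ y r x z → (y :* r :- x) :* z := y :* (r :* z) :- x :* z) refl y r x z)
               (+-congʳ (trans (*-congˡ (inverseˡ 0<z)) (*-identityʳ y)))

  ·1-pos : ∀ {n} → 1 ℕ.≤ n → 0# < n · 1#
  ·1-pos {suc n} _ = +-pos-nonneg 0<1 (·1-nonneg n)
    where
    ·1-nonneg : ∀ n → 0# ≤ n · 1#
    ·1-nonneg zero    = ≈⇒≤ refl
    ·1-nonneg (suc n) = +-nonneg (<⇒≤ 0<1) (·1-nonneg n)

  sum-nonneg : ∀ {n} (x : Fin n → Carrier) → (∀ i → 0# ≤ x i) → 0# ≤ sum x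
  sum-nonneg {zero}  x 0≤x = ≈⇒≤ refl
  sum-nonneg {suc n} x 0≤x = +-nonneg (0≤x zero) (sum-nonneg (x ∘ suc) (0≤x ∘ suc))

  sum-pos : ∀ {n} (x : Fin n → Carrier) → (∀ i → 0# ≤ x i) → ∀ i → 0# < x i → 0# < sum x
  sum-pos x 0≤x zero    0<xᵢ = +-pos-nonneg 0<xᵢ (sum-nonneg (x ∘ suc) (0≤x ∘ suc))
  sum-pos x 0≤x (suc i) 0<xᵢ = +-nonneg-pos (0≤x zero) (sum-pos (x ∘ suc) (0≤x ∘ suc) i 0<xᵢ)

-- Enumerations of a subset and of its complement.

members-∈ : ∀ {n} (p : Subset n) i → members p i ∈ p
members-∈ (inside  ∷ p) zero    = here
members-∈ (inside  ∷ p) (suc i) = there (members-∈ p i)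
members-∈ (outside ∷ p) i       = there (members-∈ p i)

∈⇒member : ∀ {n} (p : Subset n) {i} → i ∈ p → ∃[ j ] members p j ≡ i
∈⇒member (inside  ∷ p) here        = zero , ≡.refl
∈⇒member (inside  ∷ p) (there i∈p) with j , eq ← ∈⇒member p i∈p = suc j , ≡.cong suc eq
∈⇒member (outside ∷ p) (there i∈p) with j , eq ← ∈⇒member p i∈p = j , ≡.cong suc eq

-- Matching on this view rewrites an arbitrary index as an enumerated one, so that entrywise facts
-- about `↾ p` and `↾ ∁ p` combine into facts about whole vectors.
data Location {n} (p : Subset n) : Fin n → Set where
  in-p  : ∀ j → Location p (members p j)
  in-∁p : ∀ j → Location p (members (∁ p) j)

locate : ∀ {n} (p : Subset n) i → Location p i
locate p i with i ∈? p
... | yes i∈p with j , ≡.refl ← ∈⇒member p i∈p = in-p j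
... | no  i∉p with j , ≡.refl ← ∈⇒member (∁ p) (x∉p⇒x∈∁p i∉p) = in-∁p j

-- Vectors, matrices and positive definiteness.

module Linear {c ℓ₁ ℓ₂ ℓ₃ : Level} (ℝ : RealField c ℓ₁ ℓ₂ ℓ₃) where

  open RealField ℝ hiding (zero)
  open LinearAlgebra ℝ
  open Order ℝ
  open IntegerCoefficients commutativeRing
  open RingProperties (CommutativeRing.ring commutativeRing) using (-1*x≈-x; x∙y⁻¹≈ε⇒x≈y)
  open HeytingProperties heytingCommutativeRing using (1#0; #-congʳ)
  open SemiringSum semiring
    using (sum-cong-≋; ∑-distrib-+; ∑-comm; *-distribˡ-sum; *-distribʳ-sum; sum-replicate-zero)
  open SetoidReasoning (CommutativeRing.setoid commutativeRing)

  ≋-refl : ∀ {n} {x : Vector n} → x ≋ x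
  ≋-refl i = refl

  sum-zero : ∀ {n} {x : Vector n} → x ≋ 𝟎 → sum x ≈ 0#
  sum-zero {n} x≋0 = trans (sum-cong-≋ x≋0) (sum-replicate-zero n)

  infixl 6 _+ᵥ_ _-ᵥ_
  _+ᵥ_ : ∀ {n} → Vector n → Vector n → Vector n
  (x +ᵥ y) i = x i + y i

  _-ᵥ_ : ∀ {n} → Vector n → Vector n → Vector n
  (x -ᵥ y) i = x i - y i

  ∙-cong : ∀ {n} {x x′ y y′ : Vector n} → x ≋ x′ → y ≋ y′ → x ∙ y ≈ x′ ∙ y′
  ∙-cong x≋x′ y≋y′ = sum-cong-≋ (λ i → *-cong (x≋x′ i) (y≋y′ i))

  ∙-congˡ : ∀ {n} (x : Vector n) {y y′ : Vector n} → y ≋ y′ → x ∙ y ≈ x ∙ y′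
  ∙-congˡ x = ∙-cong {x = x} ≋-refl

  ∙-comm : ∀ {n} (x y : Vector n) → x ∙ y ≈ y ∙ x
  ∙-comm x y = sum-cong-≋ (λ i → *-comm (x i) (y i))

  ∙-distribˡ-+ : ∀ {n} (x y z : Vector n) → x ∙ (y +ᵥ z) ≈ x ∙ y + x ∙ z
  ∙-distribˡ-+ x y z = trans (sum-cong-≋ (λ i → distribˡ (x i) (y i) (z i)))
                             (∑-distrib-+ (λ i → x i * y i) (λ i → x i * z i))

  ∙-distribʳ-+ : ∀ {n} (z x y : Vector n) → (x +ᵥ y) ∙ z ≈ x ∙ z + y ∙ z
  ∙-distribʳ-+ z x y = trans (∙-comm (x +ᵥ y) z)
    (trans (∙-distribˡ-+ z x y) (+-cong (∙-comm z x) (∙-comm z y)))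

  ∙-*ₛʳ : ∀ {n} k (x y : Vector n) → x ∙ (k *ₛ y) ≈ k * (x ∙ y)
  ∙-*ₛʳ k x y = trans
    (sum-cong-≋ (λ i → solve 3 (λ k x y → x :* (k :* y) := k :* (x :* y)) refl k (x i) (y i)))
    (sym (*-distribˡ-sum k (λ i → x i * y i)))

  ∙-*ₛˡ : ∀ {n} k (x y : Vector n) → (k *ₛ x) ∙ y ≈ k * (x ∙ y)
  ∙-*ₛˡ k x y = trans (∙-comm (k *ₛ x) y) (trans (∙-*ₛʳ k y x) (*-congˡ (∙-comm y x)))

  ∙-distribˡ-- : ∀ {n} (x y z : Vector n) → x ∙ (y -ᵥ z) ≈ x ∙ y - x ∙ z
  ∙-distribˡ-- x y z = begin
    x ∙ (y -ᵥ z)                  ≈⟨ ∙-congˡ x (λ i → +-congˡ (-1*x≈-x (z i))) ⟨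
    x ∙ (y +ᵥ (- 1#) *ₛ z)        ≈⟨ ∙-distribˡ-+ x y _ ⟩
    x ∙ y + x ∙ ((- 1#) *ₛ z)     ≈⟨ +-congˡ (trans (∙-*ₛʳ (- 1#) x z) (-1*x≈-x (x ∙ z))) ⟩
    x ∙ y - x ∙ z                 ∎

  ∙-zeroʳ : ∀ {n} (x : Vector n) {y : Vector n} → y ≋ 𝟎 → x ∙ y ≈ 0#
  ∙-zeroʳ x y≋0 = sum-zero (λ i → trans (*-congˡ (y≋0 i)) (zeroʳ (x i)))

  *ᵥ-cong : ∀ {m n} (A : Matrix m n) {x y : Vector n} → x ≋ y → A *ᵥ x ≋ A *ᵥ y
  *ᵥ-cong A x≋y i = ∙-congˡ (A i) x≋y

  *ᵥ-*ₛ : ∀ {m n} (A : Matrix m n) k (x : Vector n) → A *ᵥ (k *ₛ x) ≋ k *ₛ (A *ᵥ x)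
  *ᵥ-*ₛ A k x i = ∙-*ₛʳ k (A i) x

  -- Both sides are the same double sum with the order of summation exchanged. Associativity of
  -- products and the symmetry of bilinear forms both rest on this.
  ∙-sumˡ : ∀ {m n} (x : Vector m) (A : Matrix m n) (y : Vector n) →
           x ∙ (A *ᵥ y) ≈ (λ j → x ∙ (λ i → A i j)) ∙ y
  ∙-sumˡ x A y = begin
    sum (λ i → x i * sum (λ j → A i j * y j))
      ≈⟨ sum-cong-≋ (λ i → trans (*-distribˡ-sum (x i) (λ j → A i j * y j))
                             (sum-cong-≋ (λ j → sym (*-assoc (x i) (A i j) (y j))))) ⟩
    sum (λ i → sum (λ j → x i * A i j * y j))
      ≈⟨ ∑-comm (λ i j → x i * A i j * y j) ⟩
    sum (λ j → sum (λ i → x i * A i j * y j))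
      ≈⟨ sum-cong-≋ (λ j → sym (*-distribʳ-sum (y j) (λ i → x i * A i j))) ⟩
    sum (λ j → sum (λ i → x i * A i j) * y j) ∎

  *ᵥ-assoc : ∀ {l m n} (A : Matrix l m) (B : Matrix m n) (x : Vector n) →
             A *ᵥ (B *ᵥ x) ≋ (A *ₘ B) *ᵥ x
  *ᵥ-assoc A B x i = ∙-sumˡ (A i) B x

  ∙-*ᵥ-comm : ∀ {n} {A : Matrix n n} → (∀ i j → A i j ≈ A j i) →
              (x y : Vector n) → x ∙ (A *ᵥ y) ≈ y ∙ (A *ᵥ x)
  ∙-*ᵥ-comm {A = A} A-sym x y = begin
    x ∙ (A *ᵥ y)                     ≈⟨ ∙-sumˡ x A y ⟩
    (λ j → x ∙ (λ i → A i j)) ∙ y    ≈⟨ ∙-comm _ y ⟩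
    y ∙ (λ j → x ∙ (λ i → A i j))    ≈⟨ ∙-congˡ y (λ j → trans (∙-comm x _) (∙-cong {y = x} (λ i → A-sym i j) ≋-refl)) ⟩
    y ∙ (A *ᵥ x)                     ∎

  δ : ∀ {n} → Fin n → Fin n → Carrier
  δ i j = indicator (i ≟ j)

  ∙-δʳ : ∀ {n} (x : Vector n) j → x ∙ (λ i → δ i j) ≈ x j
  ∙-δʳ x zero    = trans (+-cong (*-identityʳ (x zero)) (sum-zero (λ i → zeroʳ (x (suc i))))) (+-identityʳ (x zero))
  ∙-δʳ x (suc j) = trans (+-cong (zeroʳ (x zero)) (∙-δʳ (x ∘ suc) j)) (+-identityˡ (x (suc j)))

  ∙-δˡ : ∀ {n} (x : Vector n) i → δ i ∙ x ≈ x i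
  ∙-δˡ x zero    = trans (+-cong (*-identityˡ (x zero)) (sum-zero (λ i → zeroˡ (x (suc i))))) (+-identityʳ (x zero))
  ∙-δˡ x (suc i) = trans (+-cong (zeroˡ (x zero)) (∙-δˡ (x ∘ suc) i)) (+-identityˡ (x (suc i)))

  sum-split : ∀ {n} (p : Subset n) (x : Vector n) → sum x ≈ sum (x ↾ p) + sum (x ↾ ∁ p)
  sum-split []            x = sym (+-identityˡ 0#)
  sum-split (inside  ∷ p) x = trans (+-congˡ (sum-split p (x ∘ suc))) (sym (+-assoc _ _ _))
  sum-split (outside ∷ p) x = trans (+-congˡ (sum-split p (x ∘ suc)))
    (solve 3 (λ a b c → a :+ (b :+ c) := b :+ (a :+ c)) refl _ _ _)

  ∙-supported : ∀ {n} (p : Subset n) (x : Vector n) {y : Vector n} →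
                y ↾ ∁ p ≋ 𝟎 → x ∙ y ≈ (x ↾ p) ∙ (y ↾ p)
  ∙-supported p x {y} y≋0 = trans (sum-split p (λ i → x i * y i))
    (trans (+-congˡ (∙-zeroʳ (x ↾ ∁ p) y≋0)) (+-identityʳ _))

  extend : ∀ {n} (p : Subset n) → Vector ∣ p ∣ → Vector n
  extend (inside  ∷ p) x zero    = x zero
  extend (inside  ∷ p) x (suc i) = extend p (x ∘ suc) i
  extend (outside ∷ p) x zero    = 0#
  extend (outside ∷ p) x (suc i) = extend p x i

  extend-↾ : ∀ {n} (p : Subset n) (x : Vector ∣ p ∣) → extend p x ↾ p ≋ x
  extend-↾ (inside  ∷ p) x zero    = refl
  extend-↾ (inside  ∷ p) x (suc i) = extend-↾ p (x ∘ suc) i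
  extend-↾ (outside ∷ p) x i       = extend-↾ p x i

  extend-↾-∁ : ∀ {n} (p : Subset n) (x : Vector ∣ p ∣) → extend p x ↾ ∁ p ≋ 𝟎
  extend-↾-∁ (inside  ∷ p) x i       = extend-↾-∁ p (x ∘ suc) i
  extend-↾-∁ (outside ∷ p) x zero    = refl
  extend-↾-∁ (outside ∷ p) x (suc i) = extend-↾-∁ p x i

  -- Nonzero vectors are described positively, by an entry apart from zero.
  PositiveDefinite : ∀ {n} → Matrix n n → Set _
  PositiveDefinite A = ∀ x i → x i # 0# → 0# < x ∙ (A *ᵥ x)

  module _ {n : ℕ} (A : Matrix n n) (A-pd : PositiveDefinite A) where

    -- An entry apart from zero would make `x ∙ (A *ᵥ x)` positive, although it vanishes; tightness
    -- then makes every entry zero.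
    pd⇒kernel-zero : ∀ {x} → A *ᵥ x ≋ 𝟎 → x ≋ 𝟎
    pd⇒kernel-zero {x} Ax≋0 i =
      proj₁ (tight (x i) 0#) (λ xᵢ#0 → <-irrefl (sym (∙-zeroʳ x Ax≋0)) (A-pd x i xᵢ#0))

    pd⇒injective : ∀ {x y} → A *ᵥ x ≋ A *ᵥ y → x ≋ y
    pd⇒injective {x} {y} Ax≋Ay i = x∙y⁻¹≈ε⇒x≈y _ _ (pd⇒kernel-zero {x -ᵥ y} A[x-y]≋0 i)
      where
      A[x-y]≋0 : A *ᵥ (x -ᵥ y) ≋ 𝟎
      A[x-y]≋0 j = trans (∙-distribˡ-- (A j) x y) (trans (+-congʳ (Ax≋Ay j)) (-‿inverseʳ _))

    -- A negative value excludes every entry apart from zero, so `x` is zero, and then so is the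
    -- value.
    pd⇒nonneg : ∀ x → 0# ≤ x ∙ (A *ᵥ x)
    pd⇒nonneg x q<0 = <-irrefl (sum-zero (λ i → trans (*-congʳ (x≋0 i)) (zeroˡ _))) q<0
      where
      x≋0 : x ≋ 𝟎
      x≋0 i = proj₁ (tight (x i) 0#) (λ xᵢ#0 → <⇒≤ (A-pd x i xᵢ#0) q<0)

    -- Padding `x` with zeros outside `p` leaves the value of the quadratic form unchanged.
    principal-pd : (p : Subset n) → PositiveDefinite (A [ p ])
    principal-pd p x i xᵢ#0 = <-respʳ eq (A-pd x̂ (members p i) (#-congʳ (sym (extend-↾ p x i)) xᵢ#0))
      where
      x̂ : Vector n
      x̂ = extend p x
      eq : x̂ ∙ (A *ᵥ x̂) ≈ x ∙ (A [ p ] *ᵥ x)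
      eq = begin
        x̂ ∙ (A *ᵥ x̂)                       ≈⟨ ∙-comm x̂ _ ⟩
        (A *ᵥ x̂) ∙ x̂                       ≈⟨ ∙-supported p _ (extend-↾-∁ p x) ⟩
        ((A *ᵥ x̂) ↾ p) ∙ (x̂ ↾ p)           ≈⟨ ∙-cong
            (λ j → trans (∙-supported p (A (members p j)) (extend-↾-∁ p x)) (*ᵥ-cong (A [ p ]) (extend-↾ p x) j))
            (extend-↾ p x) ⟩
        (A [ p ] *ᵥ x) ∙ x                 ≈⟨ ∙-comm _ x ⟩
        x ∙ (A [ p ] *ᵥ x)                 ∎

  -- Schur complements, solvability and inverses.

  module SchurComplement {n : ℕ} (A : Matrix (suc n) (suc n)) (r : Carrier) (ra≈1 : r * A zero zero ≈ 1#) where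

    a : Carrier
    a = A zero zero

    b : Vector n
    b j = A zero (suc j)

    S : Matrix n n
    S i j = A (suc i) (suc j) - A (suc i) zero * r * b j

    infixr 5 _▹_
    _▹_ : Carrier → Vector n → Vector (suc n)
    (t ▹ y) zero    = t
    (t ▹ y) (suc i) = y i

    -- The head entry `r * (t - b ∙ y)` is what the first equation, with right-hand side `t`, gives
    -- for the first unknown, `r` being the inverse of the pivot.
    row-zero : ∀ t y → (A *ᵥ (r * (t - b ∙ y) ▹ y)) zero ≈ t
    row-zero t y = begin
      a * (r * (t - b ∙ y)) + b ∙ y
        ≈⟨ solve 4 (λ a r t s → a :* (r :* (t :- s)) :+ s := (r :* a) :* (t :- s) :+ s) refl a r t (b ∙ y) ⟩
      r * a * (t - b ∙ y) + b ∙ y   ≈⟨ +-congʳ (trans (*-congʳ ra≈1) (*-identityˡ _)) ⟩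
      t - b ∙ y + b ∙ y             ≈⟨ solve 2 (λ t s → t :- s :+ s := t) refl t (b ∙ y) ⟩
      t                             ∎

    -- Eliminating the first unknown from the remaining rows leaves `S` acting on `y`, plus a term
    -- depending on `t` only.
    row-suc : ∀ t y i → (A *ᵥ (r * (t - b ∙ y) ▹ y)) (suc i) ≈ (S *ᵥ y) i + A (suc i) zero * r * t
    row-suc t y i = begin
      e * (r * (t - b ∙ y)) + d ∙ y
        ≈⟨ solve 5 (λ e r t s u → e :* (r :* (t :- s)) :+ u := u :+ (:- (e :* r)) :* s :+ e :* r :* t) refl e r t (b ∙ y) (d ∙ y) ⟩
      d ∙ y + (- (e * r)) * (b ∙ y) + e * r * t
        ≈⟨ +-congʳ (+-congˡ (∙-*ₛˡ (- (e * r)) b y)) ⟨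
      d ∙ y + ((- (e * r)) *ₛ b) ∙ y + e * r * t
        ≈⟨ +-congʳ (∙-distribʳ-+ y d ((- (e * r)) *ₛ b)) ⟨
      (d +ᵥ (- (e * r)) *ₛ b) ∙ y + e * r * t
        ≈⟨ +-congʳ (∙-cong {y = y} (λ j → +-congˡ (solve 2 (λ k b → (:- k) :* b := :- (k :* b)) refl (e * r) (b j))) ≋-refl) ⟩
      (S *ᵥ y) i + e * r * t ∎
      where
      e : Carrier
      e = A (suc i) zero
      d : Vector n
      d j = A (suc i) (suc j)

    -- For `t = 0#` the first entry of `A *ᵥ x` vanishes and the others form `S *ᵥ y`, so the form
    -- of `S` at `y` is that of `A` at `x`.
    complement-pd : PositiveDefinite A → PositiveDefinite S
    complement-pd A-pd y i yᵢ#0 = <-respʳ eq (A-pd x (suc i) yᵢ#0)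
      where
      x : Vector (suc n)
      x = r * (0# - b ∙ y) ▹ y
      eq : x ∙ (A *ᵥ x) ≈ y ∙ (S *ᵥ y)
      eq = trans
        (+-cong (trans (*-congˡ (row-zero 0# y)) (zeroʳ _))
                (∙-congˡ y (λ j → trans (row-suc 0# y j) (trans (+-congˡ (zeroʳ _)) (+-identityʳ _)))))
        (+-identityˡ _)

  -- The pivot is the value of the form at the first basis vector.
  pd⇒pivot-pos : ∀ {n} (A : Matrix (suc n) (suc n)) → PositiveDefinite A → 0# < A zero zero
  pd⇒pivot-pos A A-pd = <-respʳ eq (A-pd e₀ zero 1#0)
    where
    e₀ : Vector _
    e₀ i = δ i zero
    eq : e₀ ∙ (A *ᵥ e₀) ≈ A zero zero
    eq = trans (∙-comm e₀ (A *ᵥ e₀)) (trans (∙-δʳ (A *ᵥ e₀) zero) (∙-δʳ (A zero) zero))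

  -- Gaussian elimination without a pivot search: the corner entry is positive, hence invertible,
  -- and the complement is again positive definite. The recursive call solves for `z` with the first
  -- equation's contribution subtracted from the right-hand side.
  pd⇒solvable : ∀ {n} (A : Matrix n n) → PositiveDefinite A → ∀ y → ∃[ x ] A *ᵥ x ≋ y
  pd⇒solvable {zero}  A A-pd y = 𝟎 , λ ()
  pd⇒solvable {suc n} A A-pd y = (r * (y zero - b ∙ z) ▹ z) , λ where
      zero    → row-zero (y zero) z
      (suc i) → trans (row-suc (y zero) z i) (trans (+-congʳ (Sz≋ i))
                  (solve 2 (λ p q → p :- q :+ q := p) refl (y (suc i)) (A (suc i) zero * r * y zero)))
    where
    0<a : 0# < A zero zero
    0<a = pd⇒pivot-pos A A-pd
    r : Carrier
    r = inverse 0<a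
    open SchurComplement A r (inverseˡ 0<a)
    reduced : ∃[ z ] S *ᵥ z ≋ (λ i → y (suc i) - A (suc i) zero * r * y zero)
    reduced = pd⇒solvable S (complement-pd A-pd) _
    z : Vector n
    z = proj₁ reduced
    Sz≋ : S *ᵥ z ≋ (λ i → y (suc i) - A (suc i) zero * r * y zero)
    Sz≋ = proj₂ reduced

  scalar-1 : ∀ {n} (i j : Fin n) → scalar 1# i j ≈ δ i j
  scalar-1 i j = *-identityˡ _

  -- Solving for each column of the identity gives a right inverse. It is a left inverse because
  -- `A (N A) = (A N) A = A = A I` and `A` is injective.
  pd⇒invertible : ∀ {n} (A : Matrix n n) → PositiveDefinite A → ∃[ N ] IsInverse A N
  pd⇒invertible {n} A A-pd = N , AN≋I , NA≋I
    where
    column : ∀ j → ∃[ x ] A *ᵥ x ≋ (λ i → scalar 1# i j)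
    column j = pd⇒solvable A A-pd _
    N : Matrix n n
    N i j = proj₁ (column j) i
    AN≋I : ∀ i → (A *ₘ N) i ≋ scalar 1# i
    AN≋I i j = proj₂ (column j) i
    NA≋I : ∀ i → (N *ₘ A) i ≋ scalar 1# i
    NA≋I i j = pd⇒injective A A-pd A[NA]≋A i
      where
      A[NA]≋A : A *ᵥ (λ i → (N *ₘ A) i j) ≋ A *ᵥ (λ i → scalar 1# i j)
      A[NA]≋A k = begin
        A k ∙ (N *ᵥ (λ l → A l j))        ≈⟨ *ᵥ-assoc A N (λ l → A l j) k ⟩
        (A *ₘ N) k ∙ (λ l → A l j)        ≈⟨ ∙-cong {y = λ l → A l j} (λ l → trans (AN≋I k l) (scalar-1 k l)) ≋-refl ⟩
        δ k ∙ (λ l → A l j)               ≈⟨ ∙-δˡ (λ l → A l j) k ⟩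
        A k j                             ≈⟨ ∙-δʳ (A k) j ⟨
        A k ∙ (λ i → δ i j)               ≈⟨ ∙-congˡ (A k) (λ i → scalar-1 i j) ⟨
        A k ∙ (λ i → scalar 1# i j)       ∎

  inverse-*ᵥ : ∀ {n} {A N : Matrix n n} → IsInverse A N → ∀ x → A *ᵥ (N *ᵥ x) ≋ x
  inverse-*ᵥ {A = A} {N} (AN≋I , _) x i = trans (*ᵥ-assoc A N x i)
    (trans (∙-cong {y = x} (λ j → trans (AN≋I i j) (scalar-1 i j)) ≋-refl) (∙-δˡ x i))

-- Quadratic forms, supports and transfers of mass.

module Quadratic {c ℓ₁ ℓ₂ ℓ₃ : Level} (ℝ : RealField c ℓ₁ ℓ₂ ℓ₃) where

  open RealField ℝ hiding (zero)
  open LinearAlgebra ℝ hiding (f; R; IsLocalMinWithSupport; Conditions)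
  open Order ℝ
  open Linear ℝ
  open IntegerCoefficients commutativeRing
  open HeytingProperties heytingCommutativeRing using (x-0≈x)
  open SetoidReasoning (CommutativeRing.setoid commutativeRing)

  module _ {n : ℕ} (M : Matrix n n) where

    form : Vector n → Carrier
    form x = x ∙ (M *ᵥ x)

    form-cong : ∀ {x y} → x ≋ y → form x ≈ form y
    form-cong x≋y = ∙-cong x≋y (*ᵥ-cong M x≋y)

    form-*ₛ : ∀ t x → form (t *ₛ x) ≈ t * t * form x
    form-*ₛ t x = begin
      (t *ₛ x) ∙ (M *ᵥ (t *ₛ x))     ≈⟨ ∙-congˡ (t *ₛ x) (*ᵥ-*ₛ M t x) ⟩
      (t *ₛ x) ∙ (t *ₛ (M *ᵥ x))     ≈⟨ ∙-*ₛˡ t x _ ⟩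
      t * (x ∙ (t *ₛ (M *ᵥ x)))      ≈⟨ *-congˡ (∙-*ₛʳ t x _) ⟩
      t * (t * form x)               ≈⟨ *-assoc t t _ ⟨
      t * t * form x                 ∎

    -- Symmetry of `M` identifies the two cross terms; they are kept as a sum of two equal terms,
    -- which suits the sign arguments below.
    form-+ : (∀ i j → M i j ≈ M j i) → ∀ x d →
             form (x +ᵥ d) ≈ form x + (d ∙ (M *ᵥ x) + d ∙ (M *ᵥ x)) + form d
    form-+ M-sym x d = begin
      (x +ᵥ d) ∙ (M *ᵥ (x +ᵥ d))
        ≈⟨ ∙-distribʳ-+ _ x d ⟩
      x ∙ (M *ᵥ (x +ᵥ d)) + d ∙ (M *ᵥ (x +ᵥ d))
        ≈⟨ +-cong (expand x) (expand d) ⟩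
      (form x + x ∙ (M *ᵥ d)) + (d ∙ (M *ᵥ x) + form d)
        ≈⟨ +-congʳ (+-congˡ (∙-*ᵥ-comm M-sym x d)) ⟩
      (form x + d ∙ (M *ᵥ x)) + (d ∙ (M *ᵥ x) + form d)
        ≈⟨ solve 3 (λ a b c → (a :+ b) :+ (b :+ c) := a :+ (b :+ b) :+ c) refl _ _ _ ⟩
      form x + (d ∙ (M *ᵥ x) + d ∙ (M *ᵥ x)) + form d ∎
      where
      expand : ∀ y → y ∙ (M *ᵥ (x +ᵥ d)) ≈ y ∙ (M *ᵥ x) + y ∙ (M *ᵥ d)
      expand y = trans (∙-congˡ y (λ i → ∙-distribˡ-+ (M i) x d)) (∙-distribˡ-+ y (M *ᵥ x) (M *ᵥ d))

  module _ {n : ℕ} {w : Vector n} {p : Subset n} (w-supp : HasSupport w p) where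

    support-∁ : w ↾ ∁ p ≋ 𝟎
    support-∁ i = proj₁ (tight _ _) (λ w#0 →
      x∈∁p⇒x∉p (members-∈ (∁ p) i) (Equivalence.to (w-supp _) w#0))

    support-pos : (∀ i → 0# ≤ w i) → ∀ i → 0# < (w ↾ p) i
    support-pos 0≤w i with Equivalence.to #⇔<⊎> (Equivalence.from (w-supp _) (members-∈ p i))
    ... | inj₁ w<0 = contradiction w<0 (0≤w _)
    ... | inj₂ 0<w = 0<w

  pos⇒HasSupport : ∀ {n} {w : Vector n} {p : Subset n} →
                   (∀ i → 0# < (w ↾ p) i) → w ↾ ∁ p ≋ 𝟎 → HasSupport w p
  pos⇒HasSupport {w = w} {p} 0<w w≋0 i = mk⇔ (to (locate p i)) (from (locate p i))
    where
    to : ∀ {i} → Location p i → w i # 0# → i ∈ p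
    to (in-p j)  _   = members-∈ p j
    to (in-∁p j) w#0 = contradiction w#0 (proj₂ (tight _ _) (w≋0 j))
    from : ∀ {i} → Location p i → i ∈ p → w i # 0#
    from (in-p j)  _   = >⇒# (0<w j)
    from (in-∁p j) i∈p = contradiction i∈p (x∈∁p⇒x∉p (members-∈ (∁ p) j))

  module _ {n : ℕ} where

    δ-nonneg : ∀ (i j : Fin n) → 0# ≤ δ i j
    δ-nonneg i j with i ≟ j
    ... | yes _ = <⇒≤ 0<1
    ... | no  _ = ≈⇒≤ refl

    δ-≤1 : ∀ (i j : Fin n) → 0# ≤ 1# - δ i j
    δ-≤1 i j with i ≟ j
    ... | yes _ = diff-nonneg (≈⇒≤ refl)
    ... | no  _ = diff-nonneg (<⇒≤ 0<1)

    -- The difference of basis vectors `eⱼ − eᵢ`, a direction of total mass zero.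
    transfer : Fin n → Fin n → Vector n
    transfer i j l = δ l j - δ l i

    ∙-transfer : ∀ x i j → x ∙ transfer i j ≈ x j - x i
    ∙-transfer x i j = trans (∙-distribˡ-- x (λ l → δ l j) (λ l → δ l i))
                             (+-cong (∙-δʳ x j) (-‿cong (∙-δʳ x i)))

    move : Carrier → Fin n → Fin n → Vector n → Vector n
    move t i j w = w +ᵥ t *ₛ transfer i j

    module _ {t : Carrier} (0<t : 0# < t) (i j : Fin n) (w : Vector n) where

      -- Each entry is a gain `t * δ l j` added to `w l - t * δ l i`; mass is lost only at `i`,
      -- where `t < w i` covers the loss.
      move-nonneg : t < w i → (∀ l → 0# ≤ w l) → ∀ l → 0# ≤ move t i j w l
      move-nonneg t<wᵢ 0≤w l = ≤-resp refl
        (solve 4 (λ w t a b → (w :- t :* b) :+ t :* a := w :+ t :* (a :- b)) refl (w l) t (δ l j) (δ l i))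
        (+-nonneg loss (*-nonneg (<⇒≤ 0<t) (δ-nonneg l j)))
        where
        loss : 0# ≤ w l - t * δ l i
        loss with l ≟ i
        ... | yes ≡.refl = ≤-resp refl (+-congˡ (-‿cong (sym (*-identityʳ t)))) (<⇒≤ (diff-pos t<wᵢ))
        ... | no  _      = ≤-resp refl (solve 2 (λ w t → w := w :- t :* con (+ 0)) refl (w l) t) (0≤w l)

      -- Entries of `transfer i j` lie between -1 and 1 because each `δ` lies between 0 and 1, so no
      -- entry moves by more than `t`.
      move-within : ∀ {ε} → t < ε → ∀ l → Within ε (move t i j w l) (w l)
      move-within {ε} t<ε l = up , down
        where
        a b : Carrier
        a = δ l j
        b = δ l i
        slack : ∀ {x} → 0# ≤ x → 0# < (ε - t) + t * x
        slack 0≤x = +-pos-nonneg (diff-pos t<ε) (*-nonneg (<⇒≤ 0<t) 0≤x)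
        up : move t i j w l - w l < ε
        up = diff-pos⁻¹ (<-respʳ
          (solve 5 (λ ε w t a b → (ε :- t) :+ t :* ((con (+ 1) :- a) :+ b) := ε :- (w :+ t :* (a :- b) :- w))
             refl ε (w l) t a b)
          (slack (+-nonneg (δ-≤1 l j) (δ-nonneg l i))))
        down : w l - move t i j w l < ε
        down = diff-pos⁻¹ (<-respʳ
          (solve 5 (λ ε w t a b → (ε :- t) :+ t :* ((con (+ 1) :- b) :+ a) := ε :- (w :- (w :+ t :* (a :- b))))
             refl ε (w l) t a b)
          (slack (+-nonneg (δ-≤1 l i) (δ-nonneg l j))))

      ∙-move : ∀ x → x ∙ move t i j w ≈ x ∙ w + t * (x j - x i)
      ∙-move x = trans (∙-distribˡ-+ x w (t *ₛ transfer i j))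
        (+-congˡ (trans (∙-*ₛʳ t x (transfer i j)) (*-congˡ (∙-transfer x i j))))

  Simplex : ∀ {n} → Carrier → Vector n → Set (ℓ₁ ⊔ ℓ₃)
  Simplex s w = (𝟏 ∙ w ≈ s) × (∀ i → 0# ≤ w i)

  -- Minimising a positive definite form over a simplex.

  module SimplexMinimum {n : ℕ} (M : Matrix n n) (M-sym : ∀ i j → M i j ≈ M j i)
                        (M-pd : PositiveDefinite M) {s : Carrier} (0<s : 0# < s) where

    -- Moving mass t from i to j changes the form by 2t(gⱼ − gᵢ) + t²q with
    -- g the half-gradient and q the value at eⱼ − eᵢ, so the change is
    -- negative once t(q + 1) < gᵢ − gⱼ.
    move-decreases : ∀ {t} (0<t : 0# < t) i j w →
                     t * (form M (transfer i j) + 1#) < (M *ᵥ w) i - (M *ᵥ w) j →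
                     form M (move t i j w) < form M w
    move-decreases {t} 0<t i j w t[q+1]<gap = diff-pos⁻¹ (<-respʳ (sym gain) 0<gain)
      where
      g p : Vector n
      g = M *ᵥ w
      p = transfer i j
      q gap : Carrier
      q = form M p
      gap = g i - g j
      d∙g : (t *ₛ p) ∙ g ≈ t * (g j - g i)
      d∙g = trans (∙-*ₛˡ t p g) (*-congˡ (trans (∙-comm p g) (∙-transfer g i j)))
      algebra : ∀ f t q gᵢ gⱼ →
                f - (f + (t * (gⱼ - gᵢ) + t * (gⱼ - gᵢ)) + t * t * q) ≈
                t * (((gᵢ - gⱼ) - t * (q + 1#)) + t + (gᵢ - gⱼ))
      algebra = solve 5 (λ f t q gᵢ gⱼ →
            f :- (f :+ (t :* (gⱼ :- gᵢ) :+ t :* (gⱼ :- gᵢ)) :+ t :* t :* q)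
            := t :* (((gᵢ :- gⱼ) :- t :* (q :+ con (+ 1))) :+ t :+ (gᵢ :- gⱼ)))
          refl
      gain : form M w - form M (move t i j w) ≈ t * ((gap - t * (q + 1#)) + t + gap)
      gain = begin
        form M w - form M (move t i j w)
          ≈⟨ +-congˡ (-‿cong (form-+ M M-sym w (t *ₛ p))) ⟩
        form M w - (form M w + ((t *ₛ p) ∙ g + (t *ₛ p) ∙ g) + form M (t *ₛ p))
          ≈⟨ +-congˡ (-‿cong (+-cong (+-congˡ (+-cong d∙g d∙g)) (form-*ₛ M t p))) ⟩
        form M w - (form M w + (t * (g j - g i) + t * (g j - g i)) + t * t * q)
          ≈⟨ algebra (form M w) t q (g i) (g j) ⟩
        t * ((gap - t * (q + 1#)) + t + gap) ∎
      0<gain : 0# < t * ((gap - t * (q + 1#)) + t + gap)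
      0<gain = *-pos 0<t (+-pos-nonneg (+-pos-nonneg (diff-pos t[q+1]<gap) (<⇒≤ 0<t))
        (<⇒≤ (≤-<-trans (*-nonneg (<⇒≤ 0<t) (+-nonneg (pd⇒nonneg M M-pd p) (<⇒≤ 0<1))) t[q+1]<gap)))

    -- First-order necessary condition: if `gⱼ < gᵢ`, a small enough transfer from `i` to `j` stays
    -- in the simplex and lowers the form.
    localMin⇒gradient-≤ : ∀ {w} → IsLocalMin (form M) (Simplex s) w →
                          ∀ i j → 0# < w i → (M *ᵥ w) i ≤ (M *ᵥ w) j
    localMin⇒gradient-≤ {w} ((Σw≈s , 0≤w) , ε , 0<ε , minimal) i j 0<wᵢ gⱼ<gᵢ =
      refute (common-lower-bound 0<wᵢ 0<ε)
      where
      g : Vector n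
      g = M *ᵥ w
      0<q+1 : 0# < form M (transfer i j) + 1#
      0<q+1 = +-nonneg-pos (pd⇒nonneg M M-pd (transfer i j)) 0<1
      v∈Simplex : ∀ {t} → 0# < t → t < w i → Simplex s (move t i j w)
      v∈Simplex {t} 0<t t<wᵢ =
        trans (∙-move 0<t i j w 𝟏) (trans (+-congˡ (trans (*-congˡ (-‿inverseʳ 1#)) (zeroʳ t))) (trans (+-identityʳ _) Σw≈s)) ,
        move-nonneg 0<t i j w t<wᵢ 0≤w
      refute : ¬ (∃[ t₁ ] 0# < t₁ × t₁ < w i × t₁ < ε)
      refute (t₁ , 0<t₁ , t₁<wᵢ , t₁<ε) =
        -- Being below `t₁`, `t` is below both `w i` and `ε`, which gives feasibility and closeness;
        -- the bound by the gap over `q + 1` makes the form decrease.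
        let t , 0<t , t<t₁ , t<gap/[q+1] = common-lower-bound 0<t₁ (*-pos (diff-pos gⱼ<gᵢ) (inverse-pos 0<q+1))
        in minimal (move t i j w) (v∈Simplex 0<t (<-trans t<t₁ t₁<wᵢ))
             (move-within 0<t i j w (<-trans t<t₁ t₁<ε))
             (move-decreases 0<t i j w (<-inverse⇒*< 0<q+1 t<gap/[q+1]))

    -- By convexity the first-order conditions already give a global minimum, with `k` as the
    -- multiplier of the mass constraint.
    kkt⇒minimum : ∀ {w} (p : Subset n) k → 𝟏 ∙ w ≈ s → w ↾ ∁ p ≋ 𝟎 →
                  (∀ i → ((M *ᵥ w) ↾ p) i ≈ k) → (∀ i → k ≤ ((M *ᵥ w) ↾ ∁ p) i) →
                  ∀ v → Simplex s v → form M w ≤ form M v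
    kkt⇒minimum {w} p k Σw≈s w≋0 g≈k k≤g v (Σv≈s , 0≤v) =
      diff-nonneg⁻¹ (≤-resp refl (sym increase)
        (+-nonneg (+-nonneg 0≤d∙g 0≤d∙g) (pd⇒nonneg M M-pd d)))
      where
      g d : Vector n
      g = M *ᵥ w
      d = v -ᵥ w
      increase : form M v - form M w ≈ (d ∙ g + d ∙ g) + form M d
      increase = trans
        (+-congʳ (trans (form-cong M (λ i → solve 2 (λ v w → v := w :+ (v :- w)) refl (v i) (w i))) (form-+ M M-sym w d)))
        (solve 3 (λ f a b → f :+ a :+ b :- f := a :+ b) refl _ _ _)
      -- Since `d` has mass zero, `g` may be replaced by `g - k`, and then every term of the sum is
      -- nonnegative.
      Σd≈0 : d ∙ (k *ₛ 𝟏) ≈ 0#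
      Σd≈0 = begin
        d ∙ (k *ₛ 𝟏)          ≈⟨ ∙-*ₛʳ k d 𝟏 ⟩
        k * (d ∙ 𝟏)           ≈⟨ *-congˡ (trans (∙-comm d 𝟏) (∙-distribˡ-- 𝟏 v w)) ⟩
        k * (𝟏 ∙ v - 𝟏 ∙ w)   ≈⟨ *-congˡ (+-cong Σv≈s (-‿cong Σw≈s)) ⟩
        k * (s - s)           ≈⟨ trans (*-congˡ (-‿inverseʳ s)) (zeroʳ k) ⟩
        0#                    ∎
      0≤term : ∀ {i} → Location p i → 0# ≤ d i * (g i - k * 1#)
      0≤term (in-p i)  = ≈⇒≤ (sym (trans (*-congˡ (trans (+-cong (g≈k i) (-‿cong (*-identityʳ k))) (-‿inverseʳ k))) (zeroʳ _)))
      0≤term (in-∁p i) = *-nonneg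
        (≤-resp refl (sym (trans (+-congˡ (-‿cong (w≋0 i))) (x-0≈x _))) (0≤v _))
        (diff-nonneg (≤-resp (sym (*-identityʳ k)) refl (k≤g i)))
      0≤d∙g : 0# ≤ d ∙ g
      0≤d∙g = ≤-resp refl
        (trans (∙-distribˡ-- d g (k *ₛ 𝟏)) (trans (+-congˡ (-‿cong Σd≈0)) (x-0≈x _)))
        (sum-nonneg _ (λ i → 0≤term (locate p i)))

    module _ (p : Subset n) (i₀ : Fin ∣ p ∣) {N : Matrix ∣ p ∣ ∣ p ∣} (N-inv : IsInverse (M [ p ]) N) where

      -- The vector on `p` whose gradient there is constantly 1; every local minimum with support
      -- `p` is a rescaling of it.
      u : Vector ∣ p ∣
      u = N *ᵥ 𝟏

      M[p]u≋𝟏 : M [ p ] *ᵥ u ≋ 𝟏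
      M[p]u≋𝟏 = inverse-*ᵥ N-inv 𝟏

      IsLocalMinOn : Vector n → Set _
      IsLocalMinOn w = IsLocalMin (form M) (Simplex s) w × HasSupport w p

      module _ {w : Vector n} (w≋0 : w ↾ ∁ p ≋ 𝟎) {k : Carrier} where

        gradient-on : w ↾ p ≋ k *ₛ u → ∀ i → ((M *ᵥ w) ↾ p) i ≈ k
        gradient-on w≋ku i = begin
          (M *ᵥ w) (members p i)        ≈⟨ ∙-supported p (M (members p i)) w≋0 ⟩
          (M [ p ] *ᵥ (w ↾ p)) i        ≈⟨ *ᵥ-cong (M [ p ]) w≋ku i ⟩
          (M [ p ] *ᵥ (k *ₛ u)) i       ≈⟨ *ᵥ-*ₛ (M [ p ]) k u i ⟩
          k * (M [ p ] *ᵥ u) i          ≈⟨ *-congˡ (M[p]u≋𝟏 i) ⟩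
          k * 1#                        ≈⟨ *-identityʳ k ⟩
          k                             ∎

        gradient-off : w ↾ p ≋ k *ₛ u → (M *ᵥ w) ↾ ∁ p ≋ k *ₛ (M ⟨ p ] *ᵥ u)
        gradient-off w≋ku i = begin
          (M *ᵥ w) (members (∁ p) i)    ≈⟨ ∙-supported p (M (members (∁ p) i)) w≋0 ⟩
          (M ⟨ p ] *ᵥ (w ↾ p)) i        ≈⟨ *ᵥ-cong (M ⟨ p ]) w≋ku i ⟩
          (M ⟨ p ] *ᵥ (k *ₛ u)) i       ≈⟨ *ᵥ-*ₛ (M ⟨ p ]) k u i ⟩
          k * (M ⟨ p ] *ᵥ u) i          ∎

        -- `M [ p ]` sends both sides to the constant vector `k`, and it is injective as a positive
        -- definite matrix.
        on-gradient : (∀ i → ((M *ᵥ w) ↾ p) i ≈ k) → w ↾ p ≋ k *ₛ u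
        on-gradient g≈k = pd⇒injective (M [ p ]) (principal-pd M M-pd p) (λ i → begin
          (M [ p ] *ᵥ (w ↾ p)) i        ≈⟨ ∙-supported p (M (members p i)) w≋0 ⟨
          (M *ᵥ w) (members p i)        ≈⟨ g≈k i ⟩
          k                             ≈⟨ *-identityʳ k ⟨
          k * 1#                        ≈⟨ *-congˡ (M[p]u≋𝟏 i) ⟨
          k * (M [ p ] *ᵥ u) i          ≈⟨ *ᵥ-*ₛ (M [ p ]) k u i ⟨
          (M [ p ] *ᵥ (k *ₛ u)) i       ∎)

        mass : w ↾ p ≋ k *ₛ u → 𝟏 ∙ w ≈ k * (𝟏 ∙ u)
        mass w≋ku = trans (∙-supported p 𝟏 w≋0) (trans (∙-congˡ 𝟏 w≋ku) (∙-*ₛʳ k 𝟏 u))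

      -- The explicit shape through which both directions and uniqueness pass; its last field pins
      -- down the scale `k`.
      record Multiple (w : Vector n) : Set (c ⊔ ℓ₁ ⊔ ℓ₃) where
        field
          k         : Carrier
          0<k       : 0# < k
          on        : w ↾ p ≋ k *ₛ u
          off       : w ↾ ∁ p ≋ 𝟎
          k*Σu≈s    : k * (𝟏 ∙ u) ≈ s

      localMin⇒multiple : ∀ {w} → IsLocalMinOn w → Multiple w
      localMin⇒multiple {w} (local@((Σw≈s , 0≤w) , _) , w-supp) = record
        { k      = k
        -- The form is positive at `w`, whose entry at `i₀` is nonzero, and equals `s * k`; the
        -- positive factor `s` cancels.
        ; 0<k    = *-cancelˡ-pos 0<s (<-respʳ formw≈sk (M-pd w (members p i₀) (>⇒# (0<w i₀))))
        ; on     = w≋ku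
        ; off    = w≋0
        ; k*Σu≈s = trans (sym (mass w≋0 w≋ku)) Σw≈s
        }
        where
        w≋0 : w ↾ ∁ p ≋ 𝟎
        w≋0 = support-∁ w-supp
        0<w : ∀ i → 0# < (w ↾ p) i
        0<w = support-pos w-supp 0≤w
        g : Vector n
        g = M *ᵥ w
        k : Carrier
        k = (g ↾ p) i₀
        -- Both indices carry positive mass, so transfers in either direction are possible and
        -- neither gradient entry is below the other.
        g≈k : ∀ i → (g ↾ p) i ≈ k
        g≈k i = ≮⇒≈ (localMin⇒gradient-≤ local (members p i₀) (members p i) (0<w i₀))
                    (localMin⇒gradient-≤ local (members p i) (members p i₀) (0<w i))
        w≋ku : w ↾ p ≋ k *ₛ u
        w≋ku = on-gradient w≋0 g≈k
        formw≈sk : form M w ≈ s * k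
        formw≈sk = begin
          w ∙ g                          ≈⟨ ∙-comm w g ⟩
          g ∙ w                          ≈⟨ ∙-supported p g w≋0 ⟩
          (g ↾ p) ∙ (w ↾ p)              ≈⟨ ∙-cong {y = w ↾ p} (λ i → trans (g≈k i) (sym (*-identityʳ k))) ≋-refl ⟩
          (k *ₛ 𝟏) ∙ (w ↾ p)             ≈⟨ ∙-*ₛˡ k 𝟏 (w ↾ p) ⟩
          k * (𝟏 ∙ (w ↾ p))              ≈⟨ *-congˡ (∙-supported p 𝟏 w≋0) ⟨
          k * (𝟏 ∙ w)                    ≈⟨ *-congˡ Σw≈s ⟩
          k * s                          ≈⟨ *-comm k s ⟩
          s * k                          ∎

      Positive Dominating : Set ℓ₃
      Positive   = ∀ i → 0# < u i
      Dominating = ∀ i → 1# ≤ (M ⟨ p ] *ᵥ u) i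

      localMin⇒conditions : ∀ {w} → IsLocalMinOn w → Positive × Dominating
      localMin⇒conditions {w} w-min@(local@((_ , 0≤w) , _) , w-supp) = positive , dominating
        where
        open Multiple (localMin⇒multiple w-min)
        positive : Positive
        positive i = *-cancelˡ-pos 0<k (<-respʳ (on i) (support-pos w-supp 0≤w i))
        dominating : Dominating
        -- If `h < 1#`, then `k * h < k`: the gradient at this outside index would be below its
        -- value at `i₀`.
        dominating i h<1 = localMin⇒gradient-≤ local (members p i₀) (members (∁ p) i) (support-pos w-supp 0≤w i₀)
          (<-resp (sym (gradient-off off on i)) (sym (gradient-on off on i₀))
            (diff-pos⁻¹ (<-respʳ (solve 2 (λ k h → k :* (con (+ 1) :- h) := k :- k :* h) refl k _) (*-pos 0<k (diff-pos h<1)))))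

      multiple⇒localMin : Positive → Dominating → ∀ {w} → Multiple w → IsLocalMinOn w
      multiple⇒localMin positive dominating {w} w-mult =
        -- The radius `1#` is arbitrary, as the minimum is global.
        ((trans (mass off on) k*Σu≈s , λ i → 0≤w (locate p i)) , 1# , 0<1 ,
          λ v v∈Simplex _ → kkt⇒minimum p k (trans (mass off on) k*Σu≈s) off (gradient-on off on) k≤g v v∈Simplex) ,
        pos⇒HasSupport 0<w off
        where
        open Multiple w-mult
        0<w : ∀ i → 0# < (w ↾ p) i
        0<w i = <-respʳ (sym (on i)) (*-pos 0<k (positive i))
        0≤w : ∀ {i} → Location p i → 0# ≤ w i
        0≤w (in-p i)  = <⇒≤ (0<w i)
        0≤w (in-∁p i) = ≈⇒≤ (sym (off i))
        k≤g : ∀ i → k ≤ ((M *ᵥ w) ↾ ∁ p) i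
        k≤g i = ≤-resp refl (sym (gradient-off off on i)) (diff-nonneg⁻¹ (≤-resp refl
          (solve 2 (λ k h → k :* (h :- con (+ 1)) := k :* h :- k) refl k _)
          (*-nonneg (<⇒≤ 0<k) (diff-nonneg (dominating i)))))

      -- Both scales satisfy `k * (𝟏 ∙ u) ≈ s`, and the positive factor `𝟏 ∙ u` cancels.
      multiple-unique : 0# < 𝟏 ∙ u → ∀ {v w} → Multiple v → Multiple w → v ≋ w
      multiple-unique 0<Σu {v} {w} v-mult w-mult i = at (locate p i)
        where
        module V = Multiple v-mult
        module W = Multiple w-mult
        k≈k : V.k ≈ W.k
        k≈k = *-cancelˡ-pos-≈ 0<Σu
          (trans (*-comm _ V.k) (trans V.k*Σu≈s (trans (sym W.k*Σu≈s) (*-comm W.k _))))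
        at : ∀ {i} → Location p i → v i ≈ w i
        at (in-p i)  = trans (V.on i) (trans (*-congʳ k≈k) (sym (W.on i)))
        at (in-∁p i) = trans (V.off i) (sym (W.off i))

      module _ (positive : Positive) where

        0<Σu : 0# < 𝟏 ∙ u
        0<Σu = sum-pos _ (λ i → <⇒≤ (0<1*u i)) i₀ (0<1*u i₀)
          where
          0<1*u : ∀ i → 0# < 1# * u i
          0<1*u i = <-respʳ (sym (*-identityˡ (u i))) (positive i)

        Σu#0 : 𝟏 ∙ u # 0#
        Σu#0 = >⇒# 0<Σu

        minimizer : Vector n
        minimizer = extend p (divide s (𝟏 ∙ u) Σu#0 *ₛ u)

        minimizer-multiple : Multiple minimizer
        minimizer-multiple = record
          { k      = divide s (𝟏 ∙ u) Σu#0
          -- `divide` unfolds to `s` times the inverse chosen by `Σu#0`, which is `inverse 0<Σu` by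
          -- definition.
          ; 0<k    = *-pos 0<s (inverse-pos 0<Σu)
          ; on     = extend-↾ p _
          ; off    = extend-↾-∁ p _
          ; k*Σu≈s = trans (*-assoc s _ _) (trans (*-congˡ (inverseˡ 0<Σu)) (*-identityʳ s))
          }

-- Edges and their endpoints.

lookup-injective : ∀ {a} {A : Set a} {xs : List A} → Unique xs →
                   ∀ {i j} → lookup xs i ≡ lookup xs j → i ≡ j
lookup-injective (x≢ ∷ xs!) {zero}  {zero}  eq = ≡.refl
lookup-injective (x≢ ∷ xs!) {zero}  {suc j} eq = contradiction eq (All.lookup x≢ (∈-lookup j))
lookup-injective (x≢ ∷ xs!) {suc i} {zero}  eq = contradiction (≡.sym eq) (All.lookup x≢ (∈-lookup i))
lookup-injective (x≢ ∷ xs!) {suc i} {suc j} eq = ≡.cong suc (lookup-injective xs! eq)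

module _ {n : ℕ} (G : Graph n) where

  open Graph G

  tail head : Fin size → Fin n
  tail = proj₁ ∘ ends
  head = proj₂ ∘ ends

  tail<head : ∀ e → tail e Fin.< head e
  tail<head e = proj₁ (All.lookup
    (all-filter (λ (u , v) → (u <? v) ×-dec adj? u v) (cartesianProduct (allFin n) (allFin n)))
    (∈-lookup e))

  -- There are no parallel edges: the edge list is filtered from a product of duplicate-free lists.
  ends-injective : ∀ {e f} → ends e ≡ ends f → e ≡ f
  ends-injective = lookup-injective
    (Unique.filter⁺ _ (Unique.cartesianProduct⁺ (Unique.allFin⁺ n) (Unique.allFin⁺ n)))

  -- `ShareVertex` with the common vertex eliminated; the four alternatives correspond to the four
  -- terms of an entry of the incidence Gram matrix.
  Meet : Fin size → Fin size → Set
  Meet e f = (tail e ≡ tail f ⊎ tail e ≡ head f) ⊎ (head e ≡ tail f ⊎ head e ≡ head f)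

  meet? : ∀ e f → Dec (Meet e f)
  meet? e f = ((tail e ≟ tail f) ⊎-dec (tail e ≟ head f)) ⊎-dec ((head e ≟ tail f) ⊎-dec (head e ≟ head f))

  shareVertex⇒meet : ∀ {e f} → ShareVertex e f → Meet e f
  shareVertex⇒meet (_ , inj₁ ≡.refl , inj₁ eq) = inj₁ (inj₁ eq)
  shareVertex⇒meet (_ , inj₁ ≡.refl , inj₂ eq) = inj₁ (inj₂ eq)
  shareVertex⇒meet (_ , inj₂ ≡.refl , inj₁ eq) = inj₂ (inj₁ eq)
  shareVertex⇒meet (_ , inj₂ ≡.refl , inj₂ eq) = inj₂ (inj₂ eq)

  meet⇒shareVertex : ∀ {e f} → Meet e f → ShareVertex e f
  meet⇒shareVertex (inj₁ (inj₁ eq)) = _ , inj₁ ≡.refl , inj₁ eq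
  meet⇒shareVertex (inj₁ (inj₂ eq)) = _ , inj₁ ≡.refl , inj₂ eq
  meet⇒shareVertex (inj₂ (inj₁ eq)) = _ , inj₂ ≡.refl , inj₁ eq
  meet⇒shareVertex (inj₂ (inj₂ eq)) = _ , inj₂ ≡.refl , inj₂ eq

  equal-ends : ∀ {e f} → e ≢ f → tail e ≡ tail f → head e ≢ head f
  equal-ends e≢f t≡t h≡h = e≢f (ends-injective (×-≡,≡→≡ (t≡t , h≡h)))

  tail≢head : ∀ e → tail e ≢ head e
  tail≢head e = Finₚ.<⇒≢ (tail<head e)

  -- Each edge is stored with its smaller end first, so this double coincidence would put `head f`
  -- below `tail f`.
  crossed-ends : ∀ {e f} → tail e ≡ head f → head e ≢ tail f
  crossed-ends {e} {f} t≡h h≡t = Finₚ.<-irrefl ≡.refl (Finₚ.<-trans (≡.subst₂ Fin._<_ t≡h h≡t (tail<head e)) (tail<head f))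

-- The Gram decomposition and positive definiteness of `M₂`.

module LineGraphMatrix {c ℓ₁ ℓ₂ ℓ₃ : Level} (ℝ : RealField c ℓ₁ ℓ₂ ℓ₃) where

  open RealField ℝ hiding (zero)
  open LinearAlgebra ℝ
  open Order ℝ
  open Linear ℝ
  open IntegerCoefficients commutativeRing
  open SetoidReasoning (CommutativeRing.setoid commutativeRing)

  indicator-yes : ∀ {a} {P : Set a} (P? : Dec P) → P → indicator P? ≈ 1#
  indicator-yes (yes _) p = refl
  indicator-yes (no ¬p) p = contradiction p ¬p

  indicator-no : ∀ {a} {P : Set a} (P? : Dec P) → ¬ P → indicator P? ≈ 0#
  indicator-no (yes p) ¬p = contradiction p ¬p
  indicator-no (no _)  ¬p = refl

  indicator-⇔ : ∀ {a b} {P : Set a} {Q : Set b} (P? : Dec P) (Q? : Dec Q) →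
                (P → Q) → (Q → P) → indicator P? ≈ indicator Q?
  indicator-⇔ (yes p) Q? to from = sym (indicator-yes Q? (to p))
  indicator-⇔ (no ¬p) Q? to from = sym (indicator-no Q? (¬p ∘ from))

  indicator-⊎ : ∀ {a b} {P : Set a} {Q : Set b} (P? : Dec P) (Q? : Dec Q) → ¬ (P × Q) →
                indicator (P? ⊎-dec Q?) ≈ indicator P? + indicator Q?
  indicator-⊎ (yes p) (yes q) disjoint = contradiction (p , q) disjoint
  indicator-⊎ (yes _) (no _)  _        = sym (+-identityʳ 1#)
  indicator-⊎ (no _)  (yes _) _        = sym (+-identityˡ 1#)
  indicator-⊎ (no _)  (no _)  _        = sym (+-identityˡ 0#)

  δ-sym : ∀ {n} (i j : Fin n) → δ i j ≈ δ j i
  δ-sym i j = indicator-⇔ (i ≟ j) (j ≟ i) ≡.sym ≡.sym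

  module _ {m n : ℕ} (A : Matrix n n) (C : Matrix m n) (a : Carrier)
           (A≈ : ∀ i j → A i j ≈ a * δ i j + sum (λ v → C v i * C v j)) where

    gram-*ᵥ : ∀ x i → (A *ᵥ x) i ≈ a * x i + sum (λ v → C v i * (C *ᵥ x) v)
    gram-*ᵥ x i = begin
      A i ∙ x
        ≈⟨ ∙-cong {y = x} (A≈ i) ≋-refl ⟩
      (a *ₛ δ i +ᵥ (λ j → sum (λ v → C v i * C v j))) ∙ x
        ≈⟨ ∙-distribʳ-+ x (a *ₛ δ i) _ ⟩
      (a *ₛ δ i) ∙ x + (λ j → sum (λ v → C v i * C v j)) ∙ x
        ≈⟨ +-cong (trans (∙-*ₛˡ a (δ i) x) (*-congˡ (∙-δˡ x i))) (sym (∙-sumˡ (λ v → C v i) C x)) ⟩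
      a * x i + sum (λ v → C v i * (C *ᵥ x) v) ∎

    gram-form : ∀ x → x ∙ (A *ᵥ x) ≈ a * (x ∙ x) + (C *ᵥ x) ∙ (C *ᵥ x)
    gram-form x = begin
      x ∙ (A *ᵥ x)
        ≈⟨ ∙-congˡ x (gram-*ᵥ x) ⟩
      x ∙ (a *ₛ x +ᵥ (λ i → (λ v → C v i) ∙ (C *ᵥ x)))
        ≈⟨ ∙-distribˡ-+ x (a *ₛ x) _ ⟩
      x ∙ (a *ₛ x) + x ∙ (λ i → (λ v → C v i) ∙ (C *ᵥ x))
        ≈⟨ +-cong (∙-*ₛʳ a x x) (trans (∙-sumˡ x (λ i v → C v i) (C *ᵥ x))
             (∙-cong {y = C *ᵥ x} (λ v → ∙-comm x (C v)) ≋-refl)) ⟩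
      a * (x ∙ x) + (C *ᵥ x) ∙ (C *ᵥ x) ∎

    -- The form is `a` times the squared length of `x` plus the squared length of `C *ᵥ x`; the
    -- first is positive thanks to entry `i`, the second nonnegative.
    gram-pd : 0# < a → PositiveDefinite A
    gram-pd 0<a x i xᵢ#0 = <-respʳ (sym (gram-form x))
      (+-pos-nonneg (*-pos 0<a (sum-pos _ (λ j → square-nonneg (x j)) i (square-pos xᵢ#0)))
                    (sum-nonneg _ (λ v → square-nonneg ((C *ᵥ x) v))))

  module _ {n : ℕ} (G : Graph n) where

    open Graph G using (size)
    private
      t h : Fin size → Fin n
      t = tail G
      h = head G

    -- A sum of two deltas rather than one indicator, so that Gram entries expand bilinearly. The
    -- ends of an edge differ, so all entries are 0 or 1.
    incidence : Matrix n size
    incidence v e = δ v (t e) + δ v (h e)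

    incidence-gram : ∀ e f → sum (λ v → incidence v e * incidence v f) ≈
                     (δ (t e) (t f) + δ (t e) (h f)) + (δ (h e) (t f) + δ (h e) (h f))
    incidence-gram e f = begin
      ((λ v → δ v (t e)) +ᵥ (λ v → δ v (h e))) ∙ (λ v → incidence v f)
        ≈⟨ ∙-distribʳ-+ (λ v → incidence v f) (λ v → δ v (t e)) (λ v → δ v (h e)) ⟩
      (λ v → δ v (t e)) ∙ (λ v → incidence v f) + (λ v → δ v (h e)) ∙ (λ v → incidence v f)
        ≈⟨ +-cong (at (t e)) (at (h e)) ⟩
      incidence (t e) f + incidence (h e) f ∎
      where
      at : ∀ u → (λ v → δ v u) ∙ (λ v → incidence v f) ≈ incidence u f
      at u = trans (∙-comm (λ v → δ v u) (λ v → incidence v f)) (∙-δʳ (λ v → incidence v f) u)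

    -- On the diagonal the Gram matrix counts the two ends of an edge, leaving 2 of the 4. Off the
    -- diagonal it counts the common ends of two distinct edges, at most one, which is their
    -- adjacency in the line graph.
    M₂≈gram : ∀ e f → M₂ G e f ≈ (1# + 1#) * δ e f + sum (λ v → incidence v e * incidence v f)
    M₂≈gram e f = trans (entry (e ≟ f)) (+-congˡ (sym (incidence-gram e f)))
      where
      entry : Dec (e ≡ f) → M₂ G e f ≈ (1# + 1#) * δ e f +
              ((δ (t e) (t f) + δ (t e) (h f)) + (δ (h e) (t f) + δ (h e) (h f)))
      entry (yes ≡.refl) = begin
        (4 · 1#) * δ e e + indicator (Graph.adj? (lineGraph G) e e)
          ≈⟨ +-cong (*-congˡ (indicator-yes (e ≟ e) ≡.refl)) (indicator-no (Graph.adj? (lineGraph G) e e) (λ (e≢e , _) → e≢e ≡.refl)) ⟩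
        (4 · 1#) * 1# + 0#
          -- `4 · 1#` computes to four ones followed by a final `0#`, hence the spelled-out left
          -- side.
          ≈⟨ solve 0 ((con (+ 1) :+ (con (+ 1) :+ (con (+ 1) :+ (con (+ 1) :+ con (+ 0))))) :* con (+ 1) :+ con (+ 0)
                      := (con (+ 1) :+ con (+ 1)) :* con (+ 1) :+ ((con (+ 1) :+ con (+ 0)) :+ (con (+ 0) :+ con (+ 1)))) refl ⟩
        (1# + 1#) * 1# + ((1# + 0#) + (0# + 1#))
          ≈⟨ +-cong (*-congˡ (indicator-yes (e ≟ e) ≡.refl))
               (+-cong (+-cong (indicator-yes (t e ≟ t e) ≡.refl) (indicator-no (t e ≟ h e) (tail≢head G e)))
                       (+-cong (indicator-no (h e ≟ t e) (tail≢head G e ∘ ≡.sym)) (indicator-yes (h e ≟ h e) ≡.refl))) ⟨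
        (1# + 1#) * δ e e + ((δ (t e) (t e) + δ (t e) (h e)) + (δ (h e) (t e) + δ (h e) (h e))) ∎
      entry (no e≢f) = begin
        (4 · 1#) * δ e f + indicator (Graph.adj? (lineGraph G) e f)
          ≈⟨ +-cong (trans (*-congˡ δ≈0) (zeroʳ _))
               (indicator-⇔ (Graph.adj? (lineGraph G) e f) (meet? G e f) (shareVertex⇒meet G ∘ proj₂)
                            (λ meet → e≢f , meet⇒shareVertex G meet)) ⟩
        0# + indicator (meet? G e f)
          ≈⟨ +-cong (sym (trans (*-congˡ δ≈0) (zeroʳ _)))
               (trans (indicator-⊎ ((t e ≟ t f) ⊎-dec (t e ≟ h f)) ((h e ≟ t f) ⊎-dec (h e ≟ h f)) tail-or-head)
                 (+-cong (indicator-⊎ (t e ≟ t f) (t e ≟ h f) (λ (p , q) → tail≢head G f (≡.trans (≡.sym p) q)))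
                         (indicator-⊎ (h e ≟ t f) (h e ≟ h f) (λ (p , q) → tail≢head G f (≡.trans (≡.sym p) q))))) ⟩
        (1# + 1#) * δ e f + ((δ (t e) (t f) + δ (t e) (h f)) + (δ (h e) (t f) + δ (h e) (h f))) ∎
        where
        δ≈0 : δ e f ≈ 0#
        δ≈0 = indicator-no (e ≟ f) e≢f
        -- Two of the four combinations would make `e` a loop, one would make `e` and `f` equal, and
        -- the crossed one contradicts the ordering of ends.
        tail-or-head : ¬ ((t e ≡ t f ⊎ t e ≡ h f) × (h e ≡ t f ⊎ h e ≡ h f))
        tail-or-head (inj₁ p , inj₁ q) = tail≢head G e (≡.trans p (≡.sym q))
        tail-or-head (inj₁ p , inj₂ q) = equal-ends G e≢f p q
        tail-or-head (inj₂ p , inj₁ q) = crossed-ends G p q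
        tail-or-head (inj₂ p , inj₂ q) = tail≢head G e (≡.trans p (≡.sym q))

    M₂-pd : PositiveDefinite (M₂ G)
    M₂-pd = gram-pd (M₂ G) incidence (1# + 1#) M₂≈gram (+-pos-nonneg 0<1 (<⇒≤ 0<1))

    M₂-sym : ∀ e f → M₂ G e f ≈ M₂ G f e
    M₂-sym e f = +-cong (*-congˡ (δ-sym e f))
      (indicator-⇔ (Graph.adj? (lineGraph G) e f) (Graph.adj? (lineGraph G) f e)
                   (Graph.sym (lineGraph G)) (Graph.sym (lineGraph G)))

-- Application of the simplex results to `M₂ G` with total mass `m`.

proposition4p17 :
    ∀ {c ℓ₁ ℓ₂ ℓ₃} (ℝ : RealField c ℓ₁ ℓ₂ ℓ₃) →
    let open RealField ℝ
        open LinearAlgebra ℝ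
    in
    ∀ {n} (G : Graph n) →
    let m = Graph.size G in
    1 ℕ.≤ m →
    (α : Subset m) → Nonempty α →
    -- N is the inverse of M₂[α]; it is unique, and its existence is part of the claim
    Σ[ N ∈ Matrix ∣ α ∣ ∣ α ∣ ] IsInverse (M₂ G [ α ]) N ×
      ((∃[ w ] IsLocalMinWithSupport G α w) ⇔ Conditions G α N) ×
      (Conditions G α N →
        Σ[ s#0 ∈ (𝟏 ∙ (N *ᵥ 𝟏)) # 0# ]
          let k = divide (m · 1#) (𝟏 ∙ (N *ᵥ 𝟏)) s#0 in
          Σ[ w ∈ Vector m ]
            (w ↾ α) ≋ (k *ₛ (N *ᵥ 𝟏)) ×
            (w ↾ ∁ α) ≋ 𝟎 ×
            IsLocalMinWithSupport G α w ×
            (∀ v → IsLocalMinWithSupport G α v → v ≋ w))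
proposition4p17 ℝ G 1≤m α (_ , i∈α) =
  N , N-inv ,
  mk⇔ (λ (_ , w-min) → localMin⇒conditions α i₀ N-inv w-min)
      (λ (positive , dominating) →
        _ , multiple⇒localMin α i₀ N-inv positive dominating (minimizer-multiple α i₀ N-inv positive)) ,
  λ (positive , dominating) →
    let w-multiple = minimizer-multiple α i₀ N-inv positive in
    Σu#0 α i₀ N-inv positive , minimizer α i₀ N-inv positive ,
    Multiple.on w-multiple , Multiple.off w-multiple ,
    multiple⇒localMin α i₀ N-inv positive dominating w-multiple ,
    λ v v-min → multiple-unique α i₀ N-inv (0<Σu α i₀ N-inv positive)
                  (localMin⇒multiple α i₀ N-inv v-min) w-multiple
  where
  open RealField ℝ using (_<_; 0#; 1#; _·_)
  open LinearAlgebra ℝ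
  open LineGraphMatrix ℝ
  open Order ℝ using (·1-pos)
  open Linear ℝ using (pd⇒invertible; principal-pd)

  0<m : 0# < Graph.size G · 1#
  0<m = ·1-pos 1≤m

  -- `f G` and `R G` unfold to `form (M₂ G)` and to the simplex of mass `m · 1#`, so the general
  -- results apply without conversion.
  open Quadratic.SimplexMinimum ℝ (M₂ G) (M₂-sym G) (M₂-pd G) 0<m

  i₀ : Fin ∣ α ∣
  i₀ = proj₁ (∈⇒member α i∈α)

  invertible : ∃[ N ] IsInverse (M₂ G [ α ]) N
  invertible = pd⇒invertible (M₂ G [ α ]) (principal-pd (M₂ G) (M₂-pd G) α)

  N : Matrix ∣ α ∣ ∣ α ∣
  N = proj₁ invertible

  N-inv : IsInverse (M₂ G [ α ]) N
  N-inv = proj₂ invertible
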